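{- Let $p$ be a prime and let $s,d,w,z_1$ be positive integers with $1\le w\le p^d$ and $1\le z_1\le p^d-w+1$. Let $z_2$ be an integer such that $z_2=1$ if $w=1$, and $z_2\in\{w-1,w\}$ if $2\le w\le p^d$. Then there exists a directed strongly regular graph with parameters $(v,k,\lambda,\mu,t)$ given by $$v=(z_1+1)p^{2sd},\quad k=(p^{sd}-1)w+z_1z_2p^{sd},\quad \lambda=p^{sd}+w^2-3w+z_1z_2^2,$$ $$\mu=w^2-w+z_1z_2^2,\quad t=p^{sd}w-w+z_1z_2^2.$$
   Context: A directed strongly regular graph (DSRG) with parameters $(v,k,\lambda,\mu,t)$ is a finite directed graph $(V,E)$ without loops, with $|V|=v$ and $E\subseteq V\times V$, such that: (1) for every vertex $x$ there are exactly $k$ vertices $y$ with $(x,y)\in E$ and exactly $k$ vertices $z$ with $(z,x)\in E$; (2) for every vertex $x$ there are exactly $t$ vertices $y$ with both $(x,y)\in E$ and $(y,x)\in E$; (3) for any two distinct vertices $x,y$, the number of vertices $z$ with $(x,z)\in E$ and $(z,y)\in E$ is $\lambda$ if $(x,y)\in E$, and $\mu$ otherwise. The undirected case $t=k$ is allowed by this definition. -}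

module Defs where

open import Data.Bool.Base using (Bool; true; false)
open import Data.Fin.Base using (Fin)
open import Data.Fin.Subset using (Subset; _∩_; ∣_∣)
open import Data.Integer.Base using (ℤ; +_)
open import Data.Nat.Base using (ℕ)
open import Data.Vec.Base using (tabulate)
open import Relation.Binary.PropositionalEquality using (_≡_; _≢_)

-- E ⊆ V × V is given by its characteristic function.
record Digraph (v : ℕ) : Set where
  field
    edge     : Fin v → Fin v → Bool
    loopless : ∀ x → edge x x ≡ false

  out : Fin v → Subset v
  out x = tabulate (λ y → edge x y)

  inn : Fin v → Subset v
  inn x = tabulate (λ z → edge z x)

-- The parameters k, ƛ, μ, t are integers so that formulas for them can use
-- genuine rather than truncated subtraction; each is equated with a cardinality.
record IsDSRG {v : ℕ} (G : Digraph v) (k ƛ μ t : ℤ) : Set where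
  open Digraph G
  field
    out-degree   : ∀ x → + ∣ out x ∣ ≡ k
    in-degree    : ∀ x → + ∣ inn x ∣ ≡ k
    reciprocal   : ∀ x → + ∣ out x ∩ inn x ∣ ≡ t
    adjacent     : ∀ x y → x ≢ y → edge x y ≡ true  → + ∣ out x ∩ inn y ∣ ≡ ƛ
    non-adjacent : ∀ x y → x ≢ y → edge x y ≡ false → + ∣ out x ∩ inn y ∣ ≡ μ

{-# OPTIONS --safe #-}

-- Let q = p^(sd) and let K be a field with p^d elements. The lines of the affine
-- plane K × K, taken in each of s coordinates, form a net of order q with p^d + 1
-- parallel classes: lines of different classes meet in exactly one point. Take
-- z₁ + 1 copies (blocks) of the q² points of the net, and give each of them w
-- classes, of which w − 1 are common to all blocks and one is its own; this uses
-- w + z₁ ≤ p^d + 1 classes. For points x, y let M(x, y) be the number of classes of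
-- the block in which x and y are collinear if both lie in the same block a, and
-- X(ℓ, m) otherwise, where ℓ and m are the lines through x and y in the own class of
-- the block of x, and X is a 0/1 matrix with all row and column sums z₂. Then
-- M² = q M + μ J if and only if (z₂ − w + 1)(z₂ − w) = 0, and A = M − w I is the
-- adjacency matrix sought.
--
-- For the field K, note that t^(p^d) = t for every t in R = 𝔽_p[Y]/(Y^(p^d) − Y).
-- The product Φ of the Y^(p^e) − Y, 1 ≤ e < d, has degree less than p^d and so is
-- nonzero in R. Modulo a maximal ideal containing the annihilator of Φ, Φ is still
-- nonzero, because that ideal contains 1 − Φ^(p^d − 1). In the resulting field the d
-- conjugates of Y are distinct, so Y is no root of a nonzero polynomial of degree
-- less than d over 𝔽_p and the p^d combinations of 1, Y, …, Y^(d−1) are distinct;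
-- being roots of T^(p^d) − T, they are all the elements.
module Submission where

open import Defs
open import Algebra.Bundles using (CommutativeRing)
import Algebra.Construct.Pointwise as Pointwise
import Algebra.Properties.Monoid.Mult as Mult
import Algebra.Properties.Semiring.Exp as Exp
open import Data.Bool.Base using (Bool; true; false; if_then_else_; not; _∧_)
open import Data.Empty using (⊥-elim)
open import Data.Fin.Base using (Fin; zero; suc; toℕ; fromℕ; fromℕ<; inject₁; inject≤; _↑ˡ_; _↑ʳ_; splitAt; combine; remQuot; punchOut; finToFun; funToFin)
open import Data.Fin.Permutation using (Permutation)
open import Data.Fin.Properties using (_≟_; any?; all?; suc-injective; toℕ<n; toℕ-injective; toℕ-fromℕ; toℕ-fromℕ<; toℕ-inject₁; inject≤-injective; ↑ˡ-injective; ↑ʳ-injective; splitAt-↑ˡ; splitAt-↑ʳ; remQuot-combine; combine-remQuot; combine-injective; punchOut-injective; finToFun-funToFin; funToFin-finToFin; <⇒notInjective)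
open import Data.Fin.Subset using (∣_∣; _∩_)
open import Data.Integer.Base as ℤ using (ℤ; +_; -[1+_]; _%ℕ_; _/ℕ_)
open import Data.Integer.Divisibility.Signed as ℤ using (divides; ∣m∣n⇒∣m+n; ∣m⇒∣m*n; ∣⇒∣ᵤ)
open import Data.Integer.DivMod using (n%ℕd<d; a≡a%ℕn+[a/ℕn]*n)
import Data.Integer.Properties as ℤ
open import Data.Integer.Tactic.RingSolver using (solve-∀)
open import Data.Nat.Base as ℕ using (ℕ; zero; suc; s≤s; z≤n; _!)
open import Data.Nat.Combinatorics using (_C_; nCn≡1; nCk≡n!/k![n-k]!; k![n∸k]!∣n!)
open import Data.Nat.Coprimality using (prime⇒coprime; coprime-Bézout)
open import Data.Nat.Divisibility as ℕ using (∣⇒≤; m∣m*n)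
open import Data.Nat.DivMod using (_%_; m%n<n; m%n%n≡m%n; m<n⇒m%n≡m; m/n*n≡m; %-distribˡ-+; [m+n]%n≡m%n)
open import Data.Nat.GCD using (module Bézout)
open import Data.Nat.Primality using (Prime; euclidsLemma; prime⇒nonZero; prime⇒nonTrivial; ¬prime[0])
import Data.Nat.Properties as ℕ
open import Data.Product.Base using (∃; Σ-syntax; _,_; proj₁; proj₂)
open import Data.Sum.Base using (_⊎_; inj₁; inj₂)
open import Data.Vec.Base using (_∷_; tabulate)
open import Function.Base using (_∘_)
open import Function.Bundles using (mk↔ₛ′)
open import Function.Definitions using (Injective)
open import Level using (0ℓ)
open import Relation.Binary.Definitions using (tri<; tri≈; tri>)
import Relation.Binary.PropositionalEquality as ≡
open ≡ using (_≡_; _≢_)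
open import Relation.Nullary using (Dec; yes; no; does; ¬_; contradiction)
open import Relation.Nullary.Decidable using (map′)

-- Tuples and pairs coded as numbers

finToFun-injective : ∀ {m n} {i j : Fin (m ℕ.^ n)} → (∀ k → finToFun {m} {n} i k ≡ finToFun j k) → i ≡ j
finToFun-injective {m} {n} {i} {j} e =
  ≡.trans (≡.sym (funToFin-finToFin {n} {m} i)) (≡.trans (funToFin-cong e) (funToFin-finToFin {n} {m} j))
  where
  funToFin-cong : ∀ {k l} {f g : Fin k → Fin l} → (∀ i → f i ≡ g i) → funToFin f ≡ funToFin g
  funToFin-cong {zero}  f≗g = ≡.refl
  funToFin-cong {suc k} f≗g = ≡.cong₂ combine (f≗g zero) (funToFin-cong (f≗g ∘ suc))

remQuot-injective : ∀ {m n} {i j : Fin (m ℕ.* n)} → proj₁ (remQuot {m} n i) ≡ proj₁ (remQuot {m} n j) →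
                    proj₂ (remQuot {m} n i) ≡ proj₂ (remQuot {m} n j) → i ≡ j
remQuot-injective {m} {n} {i} {j} e₁ e₂ =
  ≡.trans (≡.sym (combine-remQuot {m} n i)) (≡.trans (≡.cong₂ combine e₁ e₂) (combine-remQuot {m} n j))

-- Finite sums of integers, indicators and the Kronecker delta

module IntegerSums where

  open import Data.Integer.Base using (_+_; _*_)
  open import Relation.Binary.PropositionalEquality
  open import Algebra.Properties.Semiring.Sum ℤ.+-*-semiring public
  open ≡-Reasoning

  ∑-cong : ∀ {n} {f g : Fin n → ℤ} → (∀ i → f i ≡ g i) → sum f ≡ sum g
  ∑-cong = sum-cong-≗

  ∑-const : ∀ n (c : ℤ) → ∑[ i < n ] c ≡ + n * c
  ∑-const zero    c = sym (ℤ.*-zeroˡ c)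
  ∑-const (suc n) c = begin
    c + ∑[ i < n ] c   ≡⟨ cong (_+_ c) (∑-const n c) ⟩
    c + + n * c        ≡⟨ lemma c (+ n) ⟩
    (+ 1 + + n) * c    ∎
    where
    lemma : ∀ c n → c + n * c ≡ (+ 1 + n) * c
    lemma = solve-∀

  *-∑ : ∀ {n} c (f : Fin n → ℤ) → ∑[ i < n ] (c * f i) ≡ c * sum f
  *-∑ c f = sym (*-distribˡ-sum c f)

  ∑-* : ∀ {n} c (f : Fin n → ℤ) → ∑[ i < n ] (f i * c) ≡ sum f * c
  ∑-* c f = sym (*-distribʳ-sum c f)

  ∑-↑ : ∀ m {n} (f : Fin (m ℕ.+ n) → ℤ) →
        sum f ≡ ∑[ i < m ] f (i ↑ˡ n) + ∑[ j < n ] f (m ↑ʳ j)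
  ∑-↑ zero    f = sym (ℤ.+-identityˡ _)
  ∑-↑ (suc m) f = trans (cong (_+_ (f zero)) (∑-↑ m (f ∘ suc))) (sym (ℤ.+-assoc (f zero) _ _))

  ∑-combine : ∀ m n (f : Fin (m ℕ.* n) → ℤ) → sum f ≡ ∑[ i < m ] ∑[ j < n ] f (combine i j)
  ∑-combine zero    n f = refl
  ∑-combine (suc m) n f =
    trans (∑-↑ n f) (cong (_+_ (∑[ j < n ] f (j ↑ˡ (m ℕ.* n)))) (∑-combine m n (f ∘ (n ↑ʳ_))))

  -- Pigeonhole: if `y` were missed, punching it out of the codomain would leave an injection from
  -- `suc n` into `n` elements.
  injective⇒surjective : ∀ {n} {f : Fin n → Fin n} → Injective _≡_ _≡_ f → ∀ y → ∃ λ x → f x ≡ y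
  injective⇒surjective {zero}  inj ()
  injective⇒surjective {suc n} {f} inj y with any? (λ x → f x ≟ y)
  ... | yes p = p
  ... | no ¬p = ⊥-elim (<⇒notInjective {f = f′} ℕ.≤-refl
                  (λ e → inj (punchOut-injective (f≢y _) (f≢y _) e)))
    where
    f≢y : ∀ x → y ≢ f x
    f≢y x e = ¬p (x , sym e)
    f′ : Fin (suc n) → Fin n
    f′ x = punchOut (f≢y x)

  ∑-reindex : ∀ {n} {f : Fin n → Fin n} → Injective _≡_ _≡_ f →
              ∀ (g : Fin n → ℤ) → ∑[ i < n ] g (f i) ≡ sum g
  ∑-reindex {n} {f} inj g = sym (∑-permute g π)
    where
    f⁻¹ : Fin n → Fin n
    f⁻¹ y = proj₁ (injective⇒surjective inj y)
    f-f⁻¹ : ∀ y → f (f⁻¹ y) ≡ y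
    f-f⁻¹ y = proj₂ (injective⇒surjective inj y)
    π : Permutation n n
    π = mk↔ₛ′ f f⁻¹ f-f⁻¹ (λ x → inj (f-f⁻¹ (f x)))

  ⟦_⟧ : Bool → ℤ
  ⟦ b ⟧ = if b then + 1 else + 0

  ⟦∧⟧ : ∀ a b → ⟦ a ∧ b ⟧ ≡ ⟦ a ⟧ * ⟦ b ⟧
  ⟦∧⟧ true  true  = refl
  ⟦∧⟧ true  false = refl
  ⟦∧⟧ false true  = refl
  ⟦∧⟧ false false = refl

  ∣tabulate∣ : ∀ {n} (f : Fin n → Bool) → + ∣ tabulate f ∣ ≡ ∑[ i < n ] ⟦ f i ⟧
  ∣tabulate∣ {zero}  f = refl
  ∣tabulate∣ {suc n} f with f zero | ∣tabulate∣ (f ∘ suc)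
  ... | true  | ih = cong (_+_ (+ 1)) ih
  ... | false | ih = trans ih (sym (ℤ.+-identityˡ _))

  ∣tabulate∩tabulate∣ : ∀ {n} (f g : Fin n → Bool) →
                        + ∣ tabulate f ∩ tabulate g ∣ ≡ ∑[ i < n ] (⟦ f i ⟧ * ⟦ g i ⟧)
  ∣tabulate∩tabulate∣ {n} f g =
    trans (cong (λ S → + ∣ S ∣) (∩-tabulate f g))
      (trans (∣tabulate∣ (λ i → f i ∧ g i)) (∑-cong (λ i → ⟦∧⟧ (f i) (g i))))
    where
    ∩-tabulate : ∀ {n} (f g : Fin n → Bool) →
                 tabulate f ∩ tabulate g ≡ tabulate (λ i → f i ∧ g i)
    ∩-tabulate {zero}  f g = refl
    ∩-tabulate {suc n} f g = cong₂ _∷_ refl (∩-tabulate (f ∘ suc) (g ∘ suc))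

  -- Entries of the identity matrix. Being an integer, `δ` can enter polynomial identities in place
  -- of a case distinction.
  δ : ∀ {n} → Fin n → Fin n → ℤ
  δ i j = ⟦ does (i ≟ j) ⟧

  ⟦⟧-yes : ∀ {a} {A : Set a} (d : Dec A) → A → ⟦ does d ⟧ ≡ + 1
  ⟦⟧-yes (yes _) _ = refl
  ⟦⟧-yes (no ¬a) a = contradiction a ¬a

  ⟦⟧-no : ∀ {a} {A : Set a} (d : Dec A) → ¬ A → ⟦ does d ⟧ ≡ + 0
  ⟦⟧-no (yes a) ¬a = contradiction a ¬a
  ⟦⟧-no (no _)  _  = refl

  ⟦⟧-cong : ∀ {a b} {A : Set a} {B : Set b} (d : Dec A) (e : Dec B) →
            (A → B) → (B → A) → ⟦ does d ⟧ ≡ ⟦ does e ⟧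
  ⟦⟧-cong (yes a) e f g = sym (⟦⟧-yes e (f a))
  ⟦⟧-cong (no ¬a) e f g = sym (⟦⟧-no e (¬a ∘ g))

  δ-refl : ∀ {n} (i : Fin n) → δ i i ≡ + 1
  δ-refl i = ⟦⟧-yes (i ≟ i) refl

  δ-≢ : ∀ {n} {i j : Fin n} → i ≢ j → δ i j ≡ + 0
  δ-≢ {i = i} {j} = ⟦⟧-no (i ≟ j)

  δ-sym : ∀ {n} (i j : Fin n) → δ i j ≡ δ j i
  δ-sym i j = ⟦⟧-cong (i ≟ j) (j ≟ i) sym sym

  δ-suc : ∀ {n} (i j : Fin n) → δ (suc i) (suc j) ≡ δ i j
  δ-suc i j = ⟦⟧-cong (suc i ≟ suc j) (i ≟ j) suc-injective (cong suc)

  ∑δ* : ∀ {n} (i : Fin n) (f : Fin n → ℤ) → ∑[ j < n ] (δ i j * f j) ≡ f i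
  ∑δ* {suc n} zero f = begin
    + 1 * f zero + ∑[ j < n ] (+ 0 * f (suc j)) ≡⟨ cong₂ _+_ (ℤ.*-identityˡ (f zero)) (*-∑ (+ 0) (f ∘ suc)) ⟩
    f zero + + 0 * sum (f ∘ suc)                ≡⟨ ℤ.+-identityʳ (f zero) ⟩
    f zero                                      ∎
  ∑δ* {suc n} (suc i) f = begin
    + 0 * f zero + ∑[ j < n ] (δ (suc i) (suc j) * f (suc j))
      ≡⟨ ℤ.+-identityˡ _ ⟩
    ∑[ j < n ] (δ (suc i) (suc j) * f (suc j))
      ≡⟨ ∑-cong (λ j → cong (_* f (suc j)) (δ-suc i j)) ⟩
    ∑[ j < n ] (δ i j * f (suc j))
      ≡⟨ ∑δ* i (f ∘ suc) ⟩
    f (suc i) ∎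

  ∑*δ : ∀ {n} (i : Fin n) (f : Fin n → ℤ) → ∑[ j < n ] (f j * δ j i) ≡ f i
  ∑*δ i f = trans (∑-cong (λ j → trans (ℤ.*-comm (f j) _) (cong (_* f j) (δ-sym j i)))) (∑δ* i f)

  ∑δ : ∀ {n} (i : Fin n) → ∑[ j < n ] δ i j ≡ + 1
  ∑δ i = trans (∑-cong (λ j → sym (ℤ.*-identityʳ (δ i j)))) (∑δ* i (λ _ → + 1))

  ∑δ′ : ∀ {n} (i : Fin n) → ∑[ j < n ] δ j i ≡ + 1
  ∑δ′ i = trans (∑-cong (λ j → δ-sym j i)) (∑δ i)

  ZeroOne : ℤ → Set
  ZeroOne x = x ≡ + 0 ⊎ x ≡ + 1

  zeroOne-⟦⟧ : ∀ b → ZeroOne ⟦ b ⟧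
  zeroOne-⟦⟧ true  = inj₂ refl
  zeroOne-⟦⟧ false = inj₁ refl

  ∑-atMostOne : ∀ {n} {P : Fin n → Set} (P? : ∀ i → Dec (P i)) →
                (∀ {i j} → P i → P j → i ≡ j) → ZeroOne (∑[ i < n ] ⟦ does (P? i) ⟧)
  ∑-atMostOne {zero}  P? uniq = inj₁ refl
  ∑-atMostOne {suc n} P? uniq with P? zero
  ... | yes p = inj₂ (cong (_+_ (+ 1)) (trans (∑-cong rest) (sum-replicate-zero n)))
    where
    rest : ∀ i → ⟦ does (P? (suc i)) ⟧ ≡ + 0
    rest i = ⟦⟧-no (P? (suc i)) (λ q → contradiction (uniq p q) λ ())
  ... | no _  with ∑-atMostOne (P? ∘ suc) (λ p q → suc-injective (uniq p q))
  ...   | inj₁ e = inj₁ (trans (ℤ.+-identityˡ _) e)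
  ...   | inj₂ e = inj₂ (trans (ℤ.+-identityˡ _) e)

-- From a quadratic matrix equation to a directed strongly regular graph

module MatrixGraph where

  open import Data.Integer.Base using (_+_; _*_; -_; _-_)
  open import Relation.Binary.PropositionalEquality
  open IntegerSums
  open ≡-Reasoning

  module _ {N : ℕ} (M : Fin N → Fin N → ℤ) (w q μ r : ℤ)
           (diagonal : ∀ x → M x x ≡ w)
           (zeroOne : ∀ {x y} → x ≢ y → ZeroOne (M x y))
           (row-sum : ∀ x → ∑[ y < N ] M x y ≡ r)
           (column-sum : ∀ y → ∑[ x < N ] M x y ≡ r)
           (square : ∀ x y → ∑[ z < N ] (M x z * M z y) ≡ q * M x y + μ) where

    private
      -- The first factor clears the diagonal, where `M` takes the value `w`, which may itself be 1.
      edge : Fin N → Fin N → Bool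
      edge x y = not (does (x ≟ y)) ∧ does (M x y ℤ.≟ + 1)

      G : Digraph N
      G = record { edge = edge ; loopless = loopless }
        where
        loopless : ∀ x → edge x x ≡ false
        loopless x with x ≟ x
        ... | yes _   = refl
        ... | no x≢x = contradiction refl x≢x

      open Digraph G using (out; inn)

      A : Fin N → Fin N → ℤ
      A x y = ⟦ edge x y ⟧

      A≡ : ∀ x y → A x y ≡ M x y - w * δ x y
      A≡ x y with x ≟ y
      ... | yes refl = begin
        + 0                  ≡⟨ ℤ.i≡j⇒i-j≡0 (trans (diagonal x) (sym (ℤ.*-identityʳ w))) ⟨
        M x x - w * + 1      ∎
      ... | no x≢y with M x y ℤ.≟ + 1 | zeroOne x≢y
      ...   | yes e  | _ = begin
        + 1                  ≡⟨ e ⟨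
        M x y                ≡⟨ lemma (M x y) w ⟩
        M x y - w * + 0      ∎
        where
        lemma : ∀ m w → m ≡ m - w * + 0
        lemma = solve-∀
      ...   | no ne | inj₂ e = contradiction e ne
      ...   | no ne | inj₁ e = begin
        + 0                  ≡⟨ e ⟨
        M x y                ≡⟨ lemma (M x y) w ⟩
        M x y - w * + 0      ∎
        where
        lemma : ∀ m w → m ≡ m - w * + 0
        lemma = solve-∀

      ∑-minus : ∀ {n} (f g : Fin n → ℤ) → ∑[ i < n ] (f i - w * g i) ≡ sum f - w * sum g
      ∑-minus {n} f g = begin
        ∑[ i < n ] (f i - w * g i)               ≡⟨ ∑-cong (λ i → cong (_+_ (f i)) (ℤ.neg-distribˡ-* w (g i))) ⟩
        ∑[ i < n ] (f i + - w * g i)             ≡⟨ ∑-distrib-+ f (λ i → - w * g i) ⟩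
        sum f + ∑[ i < n ] (- w * g i)           ≡⟨ cong (_+_ (sum f)) (*-∑ (- w) g) ⟩
        sum f + - w * sum g                      ≡⟨ cong (_+_ (sum f)) (sym (ℤ.neg-distribˡ-* w (sum g))) ⟩
        sum f - w * sum g                        ∎

      out-degree : ∀ x → + ∣ out x ∣ ≡ r - w
      out-degree x = begin
        + ∣ out x ∣                         ≡⟨ ∣tabulate∣ (edge x) ⟩
        ∑[ y < N ] A x y                    ≡⟨ ∑-cong (A≡ x) ⟩
        ∑[ y < N ] (M x y - w * δ x y)      ≡⟨ ∑-minus (M x) (δ x) ⟩
        sum (M x) - w * sum (δ x)           ≡⟨ cong₂ (λ a b → a - w * b) (row-sum x) (∑δ x) ⟩
        r - w * + 1                         ≡⟨ cong (λ a → r - a) (ℤ.*-identityʳ w) ⟩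
        r - w                               ∎

      in-degree : ∀ x → + ∣ inn x ∣ ≡ r - w
      in-degree y = begin
        + ∣ inn y ∣                         ≡⟨ ∣tabulate∣ (λ x → edge x y) ⟩
        ∑[ x < N ] A x y                    ≡⟨ ∑-cong (λ x → A≡ x y) ⟩
        ∑[ x < N ] (M x y - w * δ x y)      ≡⟨ ∑-minus (λ x → M x y) (λ x → δ x y) ⟩
        sum (λ x → M x y) - w * sum (λ x → δ x y)
                                            ≡⟨ cong₂ (λ a b → a - w * b) (column-sum y) (∑δ′ y) ⟩
        r - w * + 1                         ≡⟨ cong (λ a → r - a) (ℤ.*-identityʳ w) ⟩
        r - w                               ∎

      -- Entrywise, (M - w I)² = M² - w M - w (M - w I). The sums against `δ` collapse, and `square`
      -- replaces M² by q M + μ J.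
      walks : ∀ x y → + ∣ out x ∩ inn y ∣ ≡ q * M x y + μ - w * M x y - w * (M x y - w * δ x y)
      walks x y = begin
        + ∣ out x ∩ inn y ∣
          ≡⟨ ∣tabulate∩tabulate∣ (edge x) (λ z → edge z y) ⟩
        ∑[ z < N ] (A x z * A z y)
          ≡⟨ ∑-cong (λ z → cong₂ _*_ (A≡ x z) (A≡ z y)) ⟩
        ∑[ z < N ] ((M x z - w * δ x z) * (M z y - w * δ z y))
          ≡⟨ ∑-cong (λ z → expand (M x z) (δ x z) (M z y) (δ z y) w) ⟩
        ∑[ z < N ] (M x z * M z y - w * (M x z * δ z y) - w * (δ x z * (M z y - w * δ z y)))
          ≡⟨ ∑-minus (λ z → M x z * M z y - w * (M x z * δ z y)) (λ z → δ x z * (M z y - w * δ z y)) ⟩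
        ∑[ z < N ] (M x z * M z y - w * (M x z * δ z y)) - w * ∑[ z < N ] (δ x z * (M z y - w * δ z y))
          ≡⟨ cong₂ (λ a b → a - w * b)
               (trans (∑-minus (λ z → M x z * M z y) (λ z → M x z * δ z y))
                      (cong₂ (λ a b → a - w * b) (square x y) (∑*δ y (M x))))
               (∑δ* x (λ z → M z y - w * δ z y)) ⟩
        q * M x y + μ - w * M x y - w * (M x y - w * δ x y) ∎
        where
        expand : ∀ a d b e w → (a - w * d) * (b - w * e) ≡ a * b - w * (a * e) - w * (d * (b - w * e))
        expand = solve-∀

    -- By `walks` the count depends on x and y only through the pair (`M x y`, `δ x y`), which is
    -- (w, 1) on the diagonal, (1, 0) on edges and (0, 0) elsewhere.
    dsrg : Σ[ G ∈ Digraph N ] IsDSRG G (r - w) (q + μ - w - w) μ (q * w + μ - w * w)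
    dsrg = G , record
      { out-degree   = out-degree
      ; in-degree    = in-degree
      ; reciprocal   = λ x → begin
          + ∣ out x ∩ inn x ∣                                       ≡⟨ walks x x ⟩
          q * M x x + μ - w * M x x - w * (M x x - w * δ x x)       ≡⟨ cong₂ (formula q μ w) (diagonal x) (δ-refl x) ⟩
          formula q μ w w (+ 1)                                     ≡⟨ diag q μ w ⟩
          q * w + μ - w * w                                         ∎
      ; adjacent     = λ x y x≢y e → begin
          + ∣ out x ∩ inn y ∣          ≡⟨ walks x y ⟩
          formula q μ w (M x y) (δ x y) ≡⟨ cong₂ (formula q μ w) (M≡ x y x≢y e) (δ-≢ x≢y) ⟩
          formula q μ w (+ 1) (+ 0)    ≡⟨ adj q μ w ⟩
          q + μ - w - w                ∎
      ; non-adjacent = λ x y x≢y e → begin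
          + ∣ out x ∩ inn y ∣          ≡⟨ walks x y ⟩
          formula q μ w (M x y) (δ x y) ≡⟨ cong₂ (formula q μ w) (M≡ x y x≢y e) (δ-≢ x≢y) ⟩
          formula q μ w (+ 0) (+ 0)    ≡⟨ nonadj q μ w ⟩
          μ                            ∎
      }
      where
      formula : (q μ w m d : ℤ) → ℤ
      formula q μ w m d = q * m + μ - w * m - w * (m - w * d)
      diag : ∀ q μ w → q * w + μ - w * w - w * (w - w * + 1) ≡ q * w + μ - w * w
      diag = solve-∀
      adj : ∀ q μ w → q * + 1 + μ - w * + 1 - w * (+ 1 - w * + 0) ≡ q + μ - w - w
      adj = solve-∀
      nonadj : ∀ q μ w → q * + 0 + μ - w * + 0 - w * (+ 0 - w * + 0) ≡ μ
      nonadj = solve-∀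
      M≡ : ∀ x y {b} → x ≢ y → edge x y ≡ b → M x y ≡ ⟦ b ⟧
      M≡ x y x≢y e = begin
        M x y              ≡⟨ undo (M x y) w ⟩
        M x y - w * + 0    ≡⟨ cong (λ d → M x y - w * d) (δ-≢ x≢y) ⟨
        M x y - w * δ x y  ≡⟨ A≡ x y ⟨
        A x y              ≡⟨ cong ⟦_⟧ e ⟩
        ⟦ _ ⟧              ∎
        where
        undo : ∀ m w → m ≡ m - w * + 0
        undo = solve-∀

-- Nets, matrices with constant row sums, and the block graph

module Nets where

  open import Data.Integer.Base using (_+_; _*_; -_; _-_)
  open import Relation.Binary.PropositionalEquality
  open import Data.Product.Base using (_×_)
  open IntegerSums
  open MatrixGraph
  open ≡-Reasoning

  -- A parallel class is encoded as a labelling of the q² points by its q lines. Only uniqueness of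
  -- intersection points is required; their existence follows by counting in `∑-line₂`.
  record Net (n q : ℕ) : Set where
    field
      line     : Fin n → Fin (q ℕ.* q) → Fin q
      separate : ∀ {i j x y} → i ≢ j → line i x ≡ line i y → line j x ≡ line j y → x ≡ y

    -- By `separate` the two labels determine the point, so they map the q² points injectively,
    -- hence bijectively, to pairs of labels. Two classes thus act as coordinates.
    ∑-line₂ : ∀ {i j} → i ≢ j → (f : Fin q → Fin q → ℤ) →
              ∑[ x < q ℕ.* q ] f (line i x) (line j x) ≡ ∑[ u < q ] ∑[ v < q ] f u v
    ∑-line₂ {i} {j} i≢j f = begin
      ∑[ x < q ℕ.* q ] f (line i x) (line j x)
        ≡⟨ ∑-cong (λ x → cong F (sym (remQuot-combine (line i x) (line j x)))) ⟩
      ∑[ x < q ℕ.* q ] F (remQuot q (φ x))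
        ≡⟨ ∑-reindex φ-injective (F ∘ remQuot q) ⟩
      ∑[ x < q ℕ.* q ] F (remQuot q x)
        ≡⟨ ∑-combine q q (F ∘ remQuot q) ⟩
      ∑[ u < q ] ∑[ v < q ] F (remQuot q (combine u v))
        ≡⟨ ∑-cong (λ u → ∑-cong (λ v → cong F (remQuot-combine u v))) ⟩
      ∑[ u < q ] ∑[ v < q ] f u v ∎
      where
      F : Fin q × Fin q → ℤ
      F (u , v) = f u v
      φ : Fin (q ℕ.* q) → Fin (q ℕ.* q)
      φ x = combine (line i x) (line j x)
      φ-injective : ∀ {x y} → φ x ≡ φ y → x ≡ y
      φ-injective {x} {y} e with combine-injective (line i x) (line j x) (line i y) (line j y) e
      ... | eᵢ , eⱼ = separate i≢j eᵢ eⱼ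

    ∑-line : ∀ {i j} → i ≢ j → (f : Fin q → ℤ) →
             ∑[ x < q ℕ.* q ] f (line i x) ≡ + q * sum f
    ∑-line i≢j f = begin
      ∑[ x < q ℕ.* q ] f (line _ x)  ≡⟨ ∑-line₂ i≢j (λ u _ → f u) ⟩
      ∑[ u < q ] ∑[ v < q ] f u      ≡⟨ ∑-cong (λ u → ∑-const q (f u)) ⟩
      ∑[ u < q ] (+ q * f u)         ≡⟨ *-∑ (+ q) f ⟩
      + q * sum f                    ∎

    ∑-line*line : ∀ {i j} → i ≢ j → (f g : Fin q → ℤ) →
                  ∑[ x < q ℕ.* q ] (f (line i x) * g (line j x)) ≡ sum f * sum g
    ∑-line*line i≢j f g = begin
      ∑[ x < q ℕ.* q ] (f (line _ x) * g (line _ x)) ≡⟨ ∑-line₂ i≢j (λ u v → f u * g v) ⟩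
      ∑[ u < q ] ∑[ v < q ] (f u * g v)             ≡⟨ ∑-cong (λ u → *-∑ (f u) g) ⟩
      ∑[ u < q ] (f u * sum g)                      ≡⟨ ∑-* (sum g) f ⟩
      sum f * sum g                                 ∎

  ∑ind< : ∀ {n z} → z ℕ.≤ n → ∑[ i < n ] ⟦ does (toℕ i ℕ.<? z) ⟧ ≡ + z
  ∑ind< {n} {zero} _ = sum-replicate-zero n
  ∑ind< {suc n} {suc z} (s≤s z≤′n) = cong (_+_ (+ 1)) (trans
    (∑-cong {n} (λ i → ⟦⟧-cong (suc (toℕ i) ℕ.<? suc z) (toℕ i ℕ.<? z) (λ { (s≤s p) → p }) s≤s))
    (∑ind< {n} {z} z≤′n))

  module Circulant (q z : ℕ) .{{_ : ℕ.NonZero q}} (z≤q : z ℕ.≤ q) where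

    private
      shift : Fin q → Fin q → Fin q
      shift u v = fromℕ< (m%n<n (toℕ u ℕ.+ toℕ v) q)

      toℕ-shift : ∀ u v → toℕ (shift u v) ≡ (toℕ u ℕ.+ toℕ v) % q
      toℕ-shift u v = toℕ-fromℕ< (m%n<n (toℕ u ℕ.+ toℕ v) q)

      -- Adding q ∸ u undoes the shift by u.
      unshift : ∀ u v → (toℕ (shift u v) ℕ.+ (q ℕ.∸ toℕ u)) % q ≡ toℕ v
      unshift u v = begin
        (toℕ (shift u v) ℕ.+ k) % q
          ≡⟨ cong (λ s → (s ℕ.+ k) % q) (toℕ-shift u v) ⟩
        ((toℕ u ℕ.+ toℕ v) % q ℕ.+ k) % q
          ≡⟨ %-distribˡ-+ ((toℕ u ℕ.+ toℕ v) % q) k q ⟩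
        ((toℕ u ℕ.+ toℕ v) % q % q ℕ.+ k % q) % q
          ≡⟨ cong (λ s → (s ℕ.+ k % q) % q) (m%n%n≡m%n (toℕ u ℕ.+ toℕ v) q) ⟩
        ((toℕ u ℕ.+ toℕ v) % q ℕ.+ k % q) % q
          ≡⟨ %-distribˡ-+ (toℕ u ℕ.+ toℕ v) k q ⟨
        (toℕ u ℕ.+ toℕ v ℕ.+ k) % q
          ≡⟨ cong (_% q) (trans (cong (ℕ._+ k) (ℕ.+-comm (toℕ u) (toℕ v)))
               (trans (ℕ.+-assoc (toℕ v) (toℕ u) k) (cong (toℕ v ℕ.+_) (ℕ.m+[n∸m]≡n (ℕ.<⇒≤ (toℕ<n u)))))) ⟩
        (toℕ v ℕ.+ q) % q
          ≡⟨ [m+n]%n≡m%n (toℕ v) q ⟩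
        toℕ v % q
          ≡⟨ m<n⇒m%n≡m (toℕ<n v) ⟩
        toℕ v ∎
        where
        k = q ℕ.∸ toℕ u

      shift-injective : ∀ u {v v′} → shift u v ≡ shift u v′ → v ≡ v′
      shift-injective u {v} {v′} e = toℕ-injective (begin
        toℕ v                                         ≡⟨ unshift u v ⟨
        (toℕ (shift u v) ℕ.+ (q ℕ.∸ toℕ u)) % q       ≡⟨ cong (λ s → (toℕ s ℕ.+ (q ℕ.∸ toℕ u)) % q) e ⟩
        (toℕ (shift u v′) ℕ.+ (q ℕ.∸ toℕ u)) % q      ≡⟨ unshift u v′ ⟩
        toℕ v′                                        ∎)

    -- The entry depends on u + v modulo q, so each row is a reordering of z ones and q - z zeros.
    -- Taking the sum and not the difference makes the matrix symmetric, whence the column sums.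
    circulant : Fin q → Fin q → ℤ
    circulant u v = ⟦ does (toℕ (shift u v) ℕ.<? z) ⟧

    circulant-row : ∀ u → ∑[ v < q ] circulant u v ≡ + z
    circulant-row u = trans (∑-reindex (shift-injective u) (λ i → ⟦ does (toℕ i ℕ.<? z) ⟧)) (∑ind< z≤q)

    circulant-sym : ∀ u v → circulant u v ≡ circulant v u
    circulant-sym u v = cong (λ s → ⟦ does (s ℕ.<? z) ⟧)
      (trans (toℕ-shift u v) (trans (cong (_% q) (ℕ.+-comm (toℕ u) (toℕ v))) (sym (toℕ-shift v u))))

    circulant-column : ∀ v → ∑[ u < q ] circulant u v ≡ + z
    circulant-column v = trans (∑-cong (λ u → circulant-sym u v)) (circulant-row v)

  -- A second class is what lets `∑-line` count the points of a line.
  other : ∀ {n} → 2 ℕ.≤ n → (i : Fin n) → ∃ λ j → i ≢ j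
  other (s≤s (s≤s _)) zero    = suc zero , λ ()
  other (s≤s (s≤s _)) (suc _) = zero , λ ()

  -- Here `k` is w - 1, the number of common classes, and `z-root` says that `z` is w - 1 or w.
  module BlockGraph {k z₁ q : ℕ} (net : Net (k ℕ.+ suc z₁) q) (1≤z₁ : 1 ℕ.≤ z₁)
                    (z : ℤ) (z-root : (z - + k) * (z - + k - + 1) ≡ + 0)
                    (X : Fin q → Fin q → ℤ)
                    (X-zeroOne : ∀ u v → ZeroOne (X u v))
                    (X-row : ∀ u → ∑[ v < q ] X u v ≡ z)
                    (X-column : ∀ v → ∑[ u < q ] X u v ≡ z) where

    open Net net

    private
      B P : ℕ
      B = suc z₁
      P = q ℕ.* q

      2≤ : 2 ℕ.≤ k ℕ.+ B
      2≤ = ℕ.≤-trans (s≤s 1≤z₁) (ℕ.m≤n+m B k)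

      -- The k core classes belong to every block, the class own a only to the block a.
      core : Fin k → Fin P → Fin q
      core i = line (i ↑ˡ B)

      own : Fin B → Fin P → Fin q
      own a = line (k ↑ʳ a)

      core≢own : ∀ i a → i ↑ˡ B ≢ k ↑ʳ a
      core≢own i a e with trans (sym (splitAt-↑ˡ k i B)) (trans (cong (splitAt k) e) (splitAt-↑ʳ k B a))
      ... | ()

      K : Fin P → Fin P → ℤ
      K x y = ∑[ i < k ] δ (core i x) (core i y)

      -- The identity matrix for a = b and X otherwise, written as a polynomial in `δ a b` so that
      -- one computation treats all pairs of blocks.
      Y : Fin B → Fin B → Fin q → Fin q → ℤ
      Y a b u v = δ a b * δ u v + (+ 1 - δ a b) * X u v

      -- Both points are read in the own class of the first block. In a product of two entries the
      -- middle point is therefore read first in class `a` and then in class `b`, and for a ≠ b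
      -- these are independent coordinates.
      M : Fin B → Fin P → Fin B → Fin P → ℤ
      M a x b y = δ a b * K x y + Y a b (own a x) (own a y)

      n : Fin B → Fin B → ℤ
      n a b = δ a b + (+ 1 - δ a b) * z

      mix-sum : ∀ d (f g : Fin q → ℤ) s → sum f ≡ + 1 → sum g ≡ s →
                ∑[ u < q ] (d * f u + (+ 1 - d) * g u) ≡ d + (+ 1 - d) * s
      mix-sum d f g s ef eg = begin
        ∑[ u < q ] (d * f u + (+ 1 - d) * g u)
          ≡⟨ ∑-distrib-+ (λ u → d * f u) (λ u → (+ 1 - d) * g u) ⟩
        ∑[ u < q ] (d * f u) + ∑[ u < q ] ((+ 1 - d) * g u)
          ≡⟨ cong₂ _+_ (trans (*-∑ d f) (trans (cong (_*_ d) ef) (ℤ.*-identityʳ d)))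
                       (trans (*-∑ (+ 1 - d) g) (cong (_*_ (+ 1 - d)) eg)) ⟩
        d + (+ 1 - d) * s ∎

      Y-row : ∀ a b u → ∑[ v < q ] Y a b u v ≡ n a b
      Y-row a b u = mix-sum (δ a b) (δ u) (X u) z (∑δ u) (X-row u)

      Y-column : ∀ a b v → ∑[ u < q ] Y a b u v ≡ n a b
      Y-column a b v = mix-sum (δ a b) (λ u → δ u v) (λ u → X u v) z (∑δ′ v) (X-column v)

      Y-diagonal : ∀ a u v → Y a a u v ≡ δ u v
      Y-diagonal a u v = trans (cong (λ d → d * δ u v + (+ 1 - d) * X u v) (δ-refl a)) (lemma (δ u v) (X u v))
        where
        lemma : ∀ d x → + 1 * d + (+ 1 - + 1) * x ≡ d
        lemma = solve-∀

      Y-off : ∀ {a b} u v → a ≢ b → Y a b u v ≡ X u v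
      Y-off u v a≢b = trans (cong (λ d → d * δ u v + (+ 1 - d) * X u v) (δ-≢ a≢b)) (lemma (δ u v) (X u v))
        where
        lemma : ∀ d x → + 0 * d + (+ 1 - + 0) * x ≡ x
        lemma = solve-∀

      n-diagonal : ∀ a → n a a ≡ + 1
      n-diagonal a = trans (cong (λ d → d + (+ 1 - d) * z) (δ-refl a)) (lemma z)
        where
        lemma : ∀ z → + 1 + (+ 1 - + 1) * z ≡ + 1
        lemma = solve-∀

      -- Collinearity in one class is an equivalence relation with classes of q points, so its
      -- matrix squares to q times itself.
      line-δ : ∀ i (x y : Fin P) → ∑[ z < P ] (δ (line i x) (line i z) * δ (line i z) (line i y)) ≡ + q * δ (line i x) (line i y)
      line-δ i x y = trans
        (∑-line (proj₂ (other 2≤ i)) (λ u → δ (line i x) u * δ u (line i y)))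
        (cong (_*_ (+ q)) (∑δ* (line i x) (λ u → δ u (line i y))))

      -- Let C_i be the collinearity matrix of core class i. Then C_i² = q C_i, and C_i C_j = J for
      -- i ≠ j because lines of different classes share exactly one point. Summing over i and j
      -- gives q K + (k² - k) J.
      K-K : ∀ x y → ∑[ t < P ] (K x t * K t y) ≡ + q * K x y + (+ k * + k - + k)
      K-K x y = begin
        ∑[ t < P ] (K x t * K t y)
          ≡⟨ ∑-cong (λ t → sym (∑-* (K t y) (λ i → δ (core i x) (core i t)))) ⟩
        ∑[ t < P ] ∑[ i < k ] (δ (core i x) (core i t) * K t y)
          ≡⟨ ∑-comm (λ t i → δ (core i x) (core i t) * K t y) ⟩
        ∑[ i < k ] ∑[ t < P ] (δ (core i x) (core i t) * K t y)
          ≡⟨ ∑-cong (λ i → ∑-cong (λ t → sym (*-∑ (δ (core i x) (core i t)) (λ j → δ (core j t) (core j y))))) ⟩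
        ∑[ i < k ] ∑[ t < P ] ∑[ j < k ] (δ (core i x) (core i t) * δ (core j t) (core j y))
          ≡⟨ ∑-cong (λ i → ∑-comm (λ t j → δ (core i x) (core i t) * δ (core j t) (core j y))) ⟩
        ∑[ i < k ] ∑[ j < k ] ∑[ t < P ] (δ (core i x) (core i t) * δ (core j t) (core j y))
          ≡⟨ ∑-cong (λ i → ∑-cong (λ j → entry i j)) ⟩
        ∑[ i < k ] ∑[ j < k ] (δ i j * (+ q * D i - + 1) + + 1)
          ≡⟨ ∑-cong (λ i → trans (∑-distrib-+ (λ j → δ i j * (+ q * D i - + 1)) (λ _ → + 1))
               (cong₂ _+_ (∑δ* i (λ _ → + q * D i - + 1)) (∑-const k (+ 1)))) ⟩
        ∑[ i < k ] (+ q * D i - + 1 + + k * + 1)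
          ≡⟨ ∑-cong (λ i → ℤ.+-assoc (+ q * D i) (- (+ 1)) (+ k * + 1)) ⟩
        ∑[ i < k ] (+ q * D i + (- (+ 1) + + k * + 1))
          ≡⟨ ∑-distrib-+ (λ i → + q * D i) (λ _ → - (+ 1) + + k * + 1) ⟩
        ∑[ i < k ] (+ q * D i) + ∑[ i < k ] (- (+ 1) + + k * + 1)
          ≡⟨ cong₂ _+_ (*-∑ (+ q) D) (trans (∑-const k (- (+ 1) + + k * + 1)) (lemma (+ k))) ⟩
        + q * K x y + (+ k * + k - + k) ∎
        where
        D : Fin k → ℤ
        D i = δ (core i x) (core i y)
        lemma : ∀ k → k * (- (+ 1) + k * + 1) ≡ k * k - k
        lemma = solve-∀
        -- One expression for both cases: q D i if i = j and 1 otherwise. The factor `δ i j` lets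
        -- `∑δ*` remove the inner sum.
        entry : ∀ i j → ∑[ t < P ] (δ (core i x) (core i t) * δ (core j t) (core j y)) ≡ δ i j * (+ q * D i - + 1) + + 1
        entry i j with i ≟ j
        ... | yes refl = trans (line-δ (i ↑ˡ B) x y) (simp (+ q * D i))
          where
          simp : ∀ a → a ≡ + 1 * (a - + 1) + + 1
          simp = solve-∀
        ... | no i≢j = trans
          (∑-line*line (i≢j ∘ ↑ˡ-injective B i j) (δ (core i x)) (λ v → δ v (core j y)))
          (trans (cong₂ _*_ (∑δ (core i x)) (∑δ′ (core j y))) (sym (simp (+ q * D i))))
          where
          simp : ∀ a → + 0 * (a - + 1) + + 1 ≡ + 1
          simp = solve-∀

      -- A core class always differs from an own class, so each core line through x meets every own
      -- line once and contributes the full sum of `f`.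
      K-own : ∀ x a (f : Fin q → ℤ) → ∑[ t < P ] (K x t * f (own a t)) ≡ + k * sum f
      K-own x a f = begin
        ∑[ t < P ] (K x t * f (own a t))
          ≡⟨ ∑-cong (λ t → sym (∑-* (f (own a t)) (λ i → δ (core i x) (core i t)))) ⟩
        ∑[ t < P ] ∑[ i < k ] (δ (core i x) (core i t) * f (own a t))
          ≡⟨ ∑-comm (λ t i → δ (core i x) (core i t) * f (own a t)) ⟩
        ∑[ i < k ] ∑[ t < P ] (δ (core i x) (core i t) * f (own a t))
          ≡⟨ ∑-cong (λ i → trans (∑-line*line (core≢own i a) (δ (core i x)) f)
               (trans (cong (_* sum f) (∑δ (core i x))) (ℤ.*-identityˡ (sum f)))) ⟩
        ∑[ i < k ] sum f
          ≡⟨ ∑-const k (sum f) ⟩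
        + k * sum f ∎

      K-sym : ∀ x y → K x y ≡ K y x
      K-sym x y = ∑-cong (λ i → δ-sym (core i x) (core i y))

      own-K : ∀ y a (f : Fin q → ℤ) → ∑[ t < P ] (f (own a t) * K t y) ≡ + k * sum f
      own-K y a f = trans
        (∑-cong (λ t → trans (ℤ.*-comm (f (own a t)) (K t y)) (cong (_* f (own a t)) (K-sym t y))))
        (K-own y a f)

      -- For a = b the first factor confines t to the line of x in class `a`, and its q points all
      -- give the same value. For a ≠ b the factors read t in different classes, and the sum splits
      -- into a row sum times a column sum. As `n a a` is 1, one formula covers both cases.
      Y-Y : ∀ a b c x y → ∑[ t < P ] (Y a b (own a x) (own a t) * Y b c (own b t) (own b y)) ≡
            δ a b * (+ q * Y a c (own a x) (own a y) - n a c) + n a b * n b c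
      Y-Y a b c x y = cases (a ≟ b)
        where
        T : ℤ
        T = + q * Y a c (own a x) (own a y)
        Goal : Fin B → Set
        Goal b = ∑[ t < P ] (Y a b (own a x) (own a t) * Y b c (own b t) (own b y)) ≡ δ a b * (T - n a c) + n a b * n b c
        cases : Dec (a ≡ b) → Goal b
        cases (yes a≡b) = subst Goal a≡b (begin
          ∑[ t < P ] (Y a a (own a x) (own a t) * Y a c (own a t) (own a y))
            ≡⟨ ∑-cong (λ t → cong (_* Y a c (own a t) (own a y)) (Y-diagonal a (own a x) (own a t))) ⟩
          ∑[ t < P ] (δ (own a x) (own a t) * Y a c (own a t) (own a y))
            ≡⟨ ∑-line (proj₂ (other 2≤ (k ↑ʳ a))) (λ u → δ (own a x) u * Y a c u (own a y)) ⟩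
          + q * ∑[ u < q ] (δ (own a x) u * Y a c u (own a y))
            ≡⟨ cong (_*_ (+ q)) (∑δ* (own a x) (λ u → Y a c u (own a y))) ⟩
          T
            ≡⟨ lemma T (n a c) ⟩
          + 1 * (T - n a c) + + 1 * n a c
            ≡⟨ cong₂ (λ d m → d * (T - n a c) + m * n a c) (δ-refl a) (n-diagonal a) ⟨
          δ a a * (T - n a c) + n a a * n a c ∎)
          where
          lemma : ∀ s m → s ≡ + 1 * (s - m) + + 1 * m
          lemma = solve-∀
        cases (no a≢b) = begin
          ∑[ t < P ] (Y a b (own a x) (own a t) * Y b c (own b t) (own b y))
            ≡⟨ ∑-line*line (a≢b ∘ ↑ʳ-injective k a b) (Y a b (own a x)) (λ v → Y b c v (own b y)) ⟩
          sum (Y a b (own a x)) * ∑[ v < q ] Y b c v (own b y)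
            ≡⟨ cong₂ _*_ (Y-row a b (own a x)) (Y-column b c (own b y)) ⟩
          n a b * n b c
            ≡⟨ lemma (n a b * n b c) (T - n a c) ⟩
          + 0 * (T - n a c) + n a b * n b c
            ≡⟨ cong (λ d → d * (T - n a c) + n a b * n b c) (δ-≢ a≢b) ⟨
          δ a b * (T - n a c) + n a b * n b c ∎
          where
          lemma : ∀ r s → r ≡ + 0 * s + r
          lemma = solve-∀

      -- As a matrix of order B, `n` is (1 - z) I + z J, and J² = B J.
      n-n : ∀ a c → ∑[ b < B ] (n a b * n b c) ≡
            δ a c * ((+ 1 - z) * (+ 1 - z)) + (+ 2 * (z * (+ 1 - z)) + + B * (z * z))
      n-n a c = begin
        ∑[ b < B ] (n a b * n b c)
          ≡⟨ ∑-cong (λ b → expand (δ a b) (δ b c) z) ⟩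
        ∑[ b < B ] (δ a b * (δ b c * ((+ 1 - z) * (+ 1 - z)) + z * (+ 1 - z)) + ((z * (+ 1 - z)) * δ b c + z * z))
          ≡⟨ ∑-distrib-+ (λ b → δ a b * (δ b c * ((+ 1 - z) * (+ 1 - z)) + z * (+ 1 - z))) (λ b → (z * (+ 1 - z)) * δ b c + z * z) ⟩
        ∑[ b < B ] (δ a b * (δ b c * ((+ 1 - z) * (+ 1 - z)) + z * (+ 1 - z))) + ∑[ b < B ] ((z * (+ 1 - z)) * δ b c + z * z)
          ≡⟨ cong₂ _+_ (∑δ* a (λ b → δ b c * ((+ 1 - z) * (+ 1 - z)) + z * (+ 1 - z)))
                       (∑-distrib-+ (λ b → (z * (+ 1 - z)) * δ b c) (λ _ → z * z)) ⟩
        δ a c * ((+ 1 - z) * (+ 1 - z)) + z * (+ 1 - z) + (∑[ b < B ] ((z * (+ 1 - z)) * δ b c) + ∑[ b < B ] (z * z))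
          ≡⟨ cong (_+_ (δ a c * ((+ 1 - z) * (+ 1 - z)) + z * (+ 1 - z)))
               (cong₂ _+_ (trans (*-∑ (z * (+ 1 - z)) (λ b → δ b c)) (cong (_*_ (z * (+ 1 - z))) (∑δ′ c))) (∑-const B (z * z))) ⟩
        δ a c * ((+ 1 - z) * (+ 1 - z)) + z * (+ 1 - z) + ((z * (+ 1 - z)) * + 1 + + B * (z * z))
          ≡⟨ collect (δ a c) z (+ B) ⟩
        δ a c * ((+ 1 - z) * (+ 1 - z)) + (+ 2 * (z * (+ 1 - z)) + + B * (z * z)) ∎
        where
        expand : ∀ d e z → (d + (+ 1 - d) * z) * (e + (+ 1 - e) * z) ≡
          d * (e * ((+ 1 - z) * (+ 1 - z)) + z * (+ 1 - z)) + ((z * (+ 1 - z)) * e + z * z)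
        expand = solve-∀
        collect : ∀ d z B → d * ((+ 1 - z) * (+ 1 - z)) + z * (+ 1 - z) + ((z * (+ 1 - z)) * + 1 + B * (z * z)) ≡
          d * ((+ 1 - z) * (+ 1 - z)) + (+ 2 * (z * (+ 1 - z)) + B * (z * z))
        collect = solve-∀

      K-row : ∀ x → ∑[ y < P ] K x y ≡ + k * + q
      K-row x = begin
        ∑[ y < P ] K x y                                   ≡⟨ ∑-comm (λ y i → δ (core i x) (core i y)) ⟩
        ∑[ i < k ] ∑[ y < P ] δ (core i x) (core i y)      ≡⟨ ∑-cong (λ i → trans (∑-line (proj₂ (other 2≤ (i ↑ˡ B))) (δ (core i x)))
                                                                (trans (cong (_*_ (+ q)) (∑δ (core i x))) (ℤ.*-identityʳ (+ q)))) ⟩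
        ∑[ i < k ] (+ q)                                   ≡⟨ ∑-const k (+ q) ⟩
        + k * + q                                          ∎

    private
      W μ r : ℤ
      W = + k + + 1
      μ = W * W - W + + z₁ * (z * z)
      r = W * + q + + z₁ * z * + q

      -- The product splits into four sums over the points t of block b: K K counts only for a = b =
      -- c, K Y for a = b, Y K for b = c, and Y Y always.
      M-square : ∀ a x c y → ∑[ b < B ] ∑[ t < P ] (M a x b t * M b t c y) ≡ + q * M a x c y + μ
      M-square a x c y = begin
        ∑[ b < B ] ∑[ t < P ] (M a x b t * M b t c y)
          ≡⟨ ∑-cong (λ b → ∑-cong (λ t → expand (δ a b) (δ b c) (K x t) (K t y) (Y a b (own a x) (own a t)) (Y b c (own b t) (own b y)))) ⟩
        ∑[ b < B ] ∑[ t < P ] (δ a b * (δ b c * (K x t * K t y)) + δ a b * (K x t * Yʳ b t)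
                                + (Yˡ b t * K t y) * δ b c + Yˡ b t * Yʳ b t)
          ≡⟨ ∑-cong (λ b → inner b) ⟩
        ∑[ b < B ] (δ a b * (δ b c * KK + + k * n b c) + (+ k * n a b) * δ b c + (δ a b * S + n a b * n b c))
          ≡⟨ ∑-cong (λ b → gather (δ a b) (δ b c * KK + + k * n b c) ((+ k * n a b) * δ b c) S (n a b * n b c)) ⟩
        ∑[ b < B ] (δ a b * (δ b c * KK + + k * n b c + S) + ((+ k * n a b) * δ b c + n a b * n b c))
          ≡⟨ ∑-distrib-+ (λ b → δ a b * (δ b c * KK + + k * n b c + S)) (λ b → (+ k * n a b) * δ b c + n a b * n b c) ⟩
        ∑[ b < B ] (δ a b * (δ b c * KK + + k * n b c + S)) + ∑[ b < B ] ((+ k * n a b) * δ b c + n a b * n b c)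
          ≡⟨ cong₂ _+_ (∑δ* a (λ b → δ b c * KK + + k * n b c + S))
               (trans (∑-distrib-+ (λ b → (+ k * n a b) * δ b c) (λ b → n a b * n b c))
                      (cong₂ _+_ (∑*δ c (λ b → + k * n a b)) (n-n a c))) ⟩
        δ a c * KK + + k * n a c + S + (+ k * n a c + (δ a c * ((+ 1 - z) * (+ 1 - z)) + (+ 2 * (z * (+ 1 - z)) + + B * (z * z))))
          -- For a = c the two sides agree whatever z is. Between different blocks the left side
          -- falls short by (z - k)(z - k - 1), which `z-root` makes zero.
          ≡⟨ final (δ a c) (+ q) (K x y) (+ k) (Y a c (own a x) (own a y)) z (+ z₁) ⟩
        + q * M a x c y + μ + (δ a c - + 1) * ((z - + k) * (z - + k - + 1))
          ≡⟨ cong (λ e → + q * M a x c y + μ + (δ a c - + 1) * e) z-root ⟩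
        + q * M a x c y + μ + (δ a c - + 1) * + 0
          ≡⟨ cong (_+_ (+ q * M a x c y + μ)) (ℤ.*-zeroʳ (δ a c - + 1)) ⟩
        + q * M a x c y + μ + + 0
          ≡⟨ ℤ.+-identityʳ _ ⟩
        + q * M a x c y + μ ∎
        where
        Yˡ Yʳ : Fin B → Fin P → ℤ
        Yˡ b t = Y a b (own a x) (own a t)
        Yʳ b t = Y b c (own b t) (own b y)
        KK S : ℤ
        KK = + q * K x y + (+ k * + k - + k)
        S = + q * Y a c (own a x) (own a y) - n a c
        expand : ∀ d e K K′ Y Y′ → (d * K + Y) * (e * K′ + Y′) ≡ d * (e * (K * K′)) + d * (K * Y′) + (Y * K′) * e + Y * Y′
        expand = solve-∀
        gather : ∀ d A B S C → d * A + B + (d * S + C) ≡ d * (A + S) + (B + C)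
        gather = solve-∀
        final : ∀ d q K k Y z z₁ →
          d * (q * K + (k * k - k)) + k * (d + (+ 1 - d) * z) + (q * Y - (d + (+ 1 - d) * z))
          + (k * (d + (+ 1 - d) * z) + (d * ((+ 1 - z) * (+ 1 - z)) + (+ 2 * (z * (+ 1 - z)) + (+ 1 + z₁) * (z * z))))
          ≡ q * (d * K + Y) + ((k + + 1) * (k + + 1) - (k + + 1) + z₁ * (z * z)) + (d - + 1) * ((z - k) * (z - k - + 1))
        final = solve-∀
        inner : ∀ b →
          ∑[ t < P ] (δ a b * (δ b c * (K x t * K t y)) + δ a b * (K x t * Yʳ b t) + (Yˡ b t * K t y) * δ b c + Yˡ b t * Yʳ b t)
          ≡ δ a b * (δ b c * KK + + k * n b c) + (+ k * n a b) * δ b c + (δ a b * S + n a b * n b c)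
        inner b = begin
          ∑[ t < P ] (f₁ t + f₂ t + f₃ t + f₄ t)
            ≡⟨ trans (∑-distrib-+ (λ t → f₁ t + f₂ t + f₃ t) f₄)
                 (cong (_+ sum f₄) (trans (∑-distrib-+ (λ t → f₁ t + f₂ t) f₃) (cong (_+ sum f₃) (∑-distrib-+ f₁ f₂)))) ⟩
          sum f₁ + sum f₂ + sum f₃ + sum f₄
            ≡⟨ cong₂ _+_ (cong₂ _+_ (cong₂ _+_ e₁ e₂) e₃) (Y-Y a b c x y) ⟩
          δ a b * (δ b c * KK) + δ a b * (+ k * n b c) + (+ k * n a b) * δ b c + (δ a b * S + n a b * n b c)
            ≡⟨ cong (λ s → s + (+ k * n a b) * δ b c + (δ a b * S + n a b * n b c)) (ℤ.*-distribˡ-+ (δ a b) (δ b c * KK) (+ k * n b c)) ⟨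
          δ a b * (δ b c * KK + + k * n b c) + (+ k * n a b) * δ b c + (δ a b * S + n a b * n b c) ∎
          where
          f₁ f₂ f₃ f₄ : Fin P → ℤ
          f₁ t = δ a b * (δ b c * (K x t * K t y))
          f₂ t = δ a b * (K x t * Yʳ b t)
          f₃ t = (Yˡ b t * K t y) * δ b c
          f₄ t = Yˡ b t * Yʳ b t
          e₁ : sum f₁ ≡ δ a b * (δ b c * KK)
          e₁ = trans (*-∑ (δ a b) (λ t → δ b c * (K x t * K t y)))
                 (cong (_*_ (δ a b)) (trans (*-∑ (δ b c) (λ t → K x t * K t y)) (cong (_*_ (δ b c)) (K-K x y))))
          e₂ : sum f₂ ≡ δ a b * (+ k * n b c)
          e₂ = trans (*-∑ (δ a b) (λ t → K x t * Yʳ b t))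
                 (cong (_*_ (δ a b)) (trans (K-own x b (λ u → Y b c u (own b y))) (cong (_*_ (+ k)) (Y-column b c (own b y)))))
          e₃ : sum f₃ ≡ (+ k * n a b) * δ b c
          e₃ = trans (∑-* (δ b c) (λ t → Yˡ b t * K t y))
                 (cong (_* δ b c) (trans (own-K y a (Y a b (own a x))) (cong (_*_ (+ k)) (Y-row a b (own a x)))))

      -- Abstracting from `δ`, `n`, `K` and `Y` lets one computation serve `M-row` and `M-column`.
      ∑M : ∀ (d : Fin B → ℤ) (m : Fin B → ℤ) (f : Fin P → ℤ) (g : Fin B → Fin P → ℤ) →
           sum d ≡ + 1 → sum f ≡ + k * + q → (∀ b → sum (g b) ≡ + q * m b) → sum m ≡ + 1 + + z₁ * z →
           ∑[ b < B ] ∑[ t < P ] (d b * f t + g b t) ≡ r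
      ∑M d m f g ed ef eg em = begin
        ∑[ b < B ] ∑[ t < P ] (d b * f t + g b t)
          ≡⟨ ∑-cong (λ b → trans (∑-distrib-+ (λ t → d b * f t) (g b)) (cong₂ _+_ (trans (*-∑ (d b) f) (cong (_*_ (d b)) ef)) (eg b))) ⟩
        ∑[ b < B ] (d b * (+ k * + q) + + q * m b)
          ≡⟨ ∑-distrib-+ (λ b → d b * (+ k * + q)) (λ b → + q * m b) ⟩
        ∑[ b < B ] (d b * (+ k * + q)) + ∑[ b < B ] (+ q * m b)
          ≡⟨ cong₂ _+_ (trans (∑-* (+ k * + q) d) (cong (_* (+ k * + q)) ed)) (trans (*-∑ (+ q) m) (cong (_*_ (+ q)) em)) ⟩
        + 1 * (+ k * + q) + + q * (+ 1 + + z₁ * z)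
          ≡⟨ lemma (+ k) (+ q) (+ z₁) z ⟩
        r ∎
        where
        lemma : ∀ k q z₁ z → + 1 * (k * q) + q * (+ 1 + z₁ * z) ≡ (k + + 1) * q + z₁ * z * q
        lemma = solve-∀

      ∑mix : ∀ (d : Fin B → ℤ) → sum d ≡ + 1 → ∑[ b < B ] (d b + (+ 1 - d b) * z) ≡ + 1 + + z₁ * z
      ∑mix d e = begin
        ∑[ b < B ] (d b + (+ 1 - d b) * z)        ≡⟨ ∑-cong (λ b → split (d b) z) ⟩
        ∑[ b < B ] (d b * (+ 1 - z) + z)          ≡⟨ ∑-distrib-+ (λ b → d b * (+ 1 - z)) (λ _ → z) ⟩
        ∑[ b < B ] (d b * (+ 1 - z)) + ∑[ b < B ] z
          ≡⟨ cong₂ _+_ (trans (∑-* (+ 1 - z) d) (cong (_* (+ 1 - z)) e)) (∑-const B z) ⟩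
        + 1 * (+ 1 - z) + + B * z                 ≡⟨ lemma z (+ z₁) ⟩
        + 1 + + z₁ * z                            ∎
        where
        split : ∀ d z → d + (+ 1 - d) * z ≡ d * (+ 1 - z) + z
        split = solve-∀
        lemma : ∀ z z₁ → + 1 * (+ 1 - z) + (+ 1 + z₁) * z ≡ + 1 + z₁ * z
        lemma = solve-∀

      M-row : ∀ a x → ∑[ b < B ] ∑[ t < P ] M a x b t ≡ r
      M-row a x = ∑M (δ a) (n a) (K x) (λ b t → Y a b (own a x) (own a t)) (∑δ a) (K-row x)
        (λ b → trans (∑-line (proj₂ (other 2≤ (k ↑ʳ a))) (Y a b (own a x))) (cong (_*_ (+ q)) (Y-row a b (own a x))))
        (∑mix (δ a) (∑δ a))

      M-column : ∀ b y → ∑[ a < B ] ∑[ t < P ] M a t b y ≡ r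
      M-column b y = ∑M (λ a → δ a b) (λ a → n a b) (λ t → K t y) (λ a t → Y a b (own a t) (own a y)) (∑δ′ b)
        (trans (∑-cong (λ t → K-sym t y)) (K-row y))
        (λ a → trans (∑-line (proj₂ (other 2≤ (k ↑ʳ a))) (λ u → Y a b u (own a y))) (cong (_*_ (+ q)) (Y-column a b (own a y))))
        (∑mix (λ a → δ a b) (∑δ′ b))

      M-block : ∀ a x y → M a x a y ≡ δ (own a x) (own a y) + K x y
      M-block a x y = begin
        δ a a * K x y + Y a a (own a x) (own a y)  ≡⟨ cong₂ (λ d e → d * K x y + e) (δ-refl a) (Y-diagonal a (own a x) (own a y)) ⟩
        + 1 * K x y + δ (own a x) (own a y)        ≡⟨ lemma (K x y) (δ (own a x) (own a y)) ⟩
        δ (own a x) (own a y) + K x y              ∎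
        where
        lemma : ∀ k d → + 1 * k + d ≡ d + k
        lemma = solve-∀

      M-diagonal : ∀ a x → M a x a x ≡ W
      M-diagonal a x = begin
        M a x a x                      ≡⟨ M-block a x x ⟩
        δ (own a x) (own a x) + K x x  ≡⟨ cong₂ _+_ (δ-refl (own a x)) (trans (∑-cong (λ i → δ-refl (core i x))) (∑-const k (+ 1))) ⟩
        + 1 + + k * + 1                ≡⟨ lemma (+ k) ⟩
        W                              ∎
        where
        lemma : ∀ k → + 1 + k * + 1 ≡ k + + 1
        lemma = solve-∀

      -- Inside a block, distinct points have at most one common line among the k + 1 classes;
      -- between blocks the entry is one of X. The premise admits x = y for a ≠ b, since one point
      -- in two blocks gives two vertices.
      M-zeroOne : ∀ a x b y → (a ≡ b → x ≢ y) → ZeroOne (M a x b y)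
      M-zeroOne a x b y x≢y = cases (a ≟ b)
        where
        -- The own class is listed first, in agreement with `M-block`, so that the sum of indicators
        -- is literally the entry.
        ix : Fin (suc k) → Fin (k ℕ.+ B)
        ix zero    = k ↑ʳ a
        ix (suc i) = i ↑ˡ B
        cls : Fin (suc k) → Fin P → Fin q
        cls zero    = own a
        cls (suc i) = core i
        cls≡ : ∀ i t → cls i t ≡ line (ix i) t
        cls≡ zero    t = refl
        cls≡ (suc i) t = refl
        ix-injective : ∀ {i j} → ix i ≡ ix j → i ≡ j
        ix-injective {zero}  {zero}  e = refl
        ix-injective {zero}  {suc j} e = contradiction (sym e) (core≢own j a)
        ix-injective {suc i} {zero}  e = contradiction e (core≢own i a)
        ix-injective {suc i} {suc j} e = cong suc (↑ˡ-injective B i j e)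
        unique : x ≢ y → ∀ i j → cls i x ≡ cls i y → cls j x ≡ cls j y → i ≡ j
        unique x≢y i j eᵢ eⱼ with i ≟ j
        ... | yes i≡j = i≡j
        ... | no i≢j  = contradiction
          (separate (i≢j ∘ ix-injective)
            (trans (sym (cls≡ i x)) (trans eᵢ (cls≡ i y)))
            (trans (sym (cls≡ j x)) (trans eⱼ (cls≡ j y))))
          x≢y
        cases : Dec (a ≡ b) → ZeroOne (M a x b y)
        cases (yes a≡b) = subst (λ b → ZeroOne (M a x b y)) a≡b
          (subst ZeroOne (sym (M-block a x y)) (∑-atMostOne (λ i → cls i x ≟ cls i y) (λ {i} {j} → unique (x≢y a≡b) i j)))
        cases (no a≢b) = subst ZeroOne (sym (begin
          δ a b * K x y + Y a b (own a x) (own a y)  ≡⟨ cong₂ (λ d e → d * K x y + e) (δ-≢ a≢b) (Y-off (own a x) (own a y) a≢b) ⟩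
          + 0 * K x y + X (own a x) (own a y)        ≡⟨ ℤ.+-identityˡ _ ⟩
          X (own a x) (own a y)                      ∎)) (X-zeroOne (own a x) (own a y))

      V : ℕ
      V = B ℕ.* P

      block : Fin V → Fin B
      block v = proj₁ (remQuot P v)

      point : Fin V → Fin P
      point v = proj₂ (remQuot {B} P v)

      ∑-vertex : ∀ (F : Fin B → Fin P → ℤ) → ∑[ v < V ] F (block v) (point v) ≡ ∑[ b < B ] ∑[ t < P ] F b t
      ∑-vertex F = trans (∑-combine B P (λ v → F (block v) (point v)))
        (∑-cong (λ b → ∑-cong (λ t → cong (λ (b , t) → F b t) (remQuot-combine b t))))

      matrix : Fin V → Fin V → ℤ
      matrix u v = M (block u) (point u) (block v) (point v)

      matrix-zeroOne : ∀ {u v} → u ≢ v → ZeroOne (matrix u v)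
      matrix-zeroOne {u} {v} u≢v = M-zeroOne (block u) (point u) (block v) (point v)
        (λ e e′ → u≢v (remQuot-injective {B} e e′))

    blockGraph : Σ[ G ∈ Digraph V ] IsDSRG G (r - W) (+ q + μ - W - W) μ (+ q * W + μ - W * W)
    blockGraph = dsrg matrix W (+ q) μ r
      (λ u → M-diagonal (block u) (point u))
      matrix-zeroOne
      (λ u → trans (∑-vertex (M (block u) (point u))) (M-row (block u) (point u)))
      (λ v → trans (∑-vertex (λ b t → M b t (block v) (point v))) (M-column (block v) (point v)))
      (λ u v → trans (∑-vertex (λ b t → M (block u) (point u) b t * M b t (block v) (point v)))
                     (M-square (block u) (point u) (block v) (point v)))

-- Ideals and quotient rings

module Ideals (R : CommutativeRing 0ℓ 0ℓ) where

  open CommutativeRing R hiding (zero)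
  open Exp semiring using (_^_)
  open import Data.Product.Base using (_×_)
  open import Algebra.Properties.Ring ring
  open import Algebra.Properties.CommutativeSemigroup *-commutativeSemigroup using () renaming (x∙yz≈y∙xz to x*yz≈y*xz)
  open import Algebra.Properties.CommutativeSemigroup +-commutativeSemigroup using (interchange)
  open import Relation.Binary.Reasoning.Setoid setoid

  record Ideal : Set₁ where
    field
      Member   : Carrier → Set
      respects : ∀ {x y} → x ≈ y → Member x → Member y
      0∈       : Member 0#
      +-closed : ∀ {x y} → Member x → Member y → Member (x + y)
      absorbs  : ∀ r {x} → Member x → Member (r * x)

    neg-closed : ∀ {x} → Member x → Member (- x)
    neg-closed {x} x∈ = respects (-1*x≈-x x) (absorbs (- 1#) x∈)

  open Ideal

  telescope : ∀ x y z → (x - y) + (y - z) ≈ x - z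
  telescope x y z = begin
    (x - y) + (y - z)      ≈⟨ +-assoc x (- y) (y - z) ⟩
    x + (- y + (y - z))    ≈⟨ +-congˡ (+-assoc (- y) y (- z)) ⟨
    x + ((- y + y) - z)    ≈⟨ +-congˡ (+-congʳ (-‿inverseˡ y)) ⟩
    x + (0# - z)           ≈⟨ +-congˡ (+-identityˡ (- z)) ⟩
    x - z                  ∎

  -- Inserting x y′ exhibits the difference as a combination of x - x′ and y - y′, so multiplication
  -- is well defined modulo an ideal.
  difference-of-products : ∀ x x′ y y′ → x * (y - y′) + y′ * (x - x′) ≈ x * y - x′ * y′
  difference-of-products x x′ y y′ = begin
    x * (y - y′) + y′ * (x - x′)                  ≈⟨ +-cong (x[y-z]≈xy-xz x y y′) (x[y-z]≈xy-xz y′ x x′) ⟩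
    (x * y - x * y′) + (y′ * x - y′ * x′)         ≈⟨ +-congˡ (+-cong (*-comm y′ x) (-‿cong (*-comm y′ x′))) ⟩
    (x * y - x * y′) + (x * y′ - x′ * y′)         ≈⟨ telescope (x * y) (x * y′) (x′ * y′) ⟩
    x * y - x′ * y′                               ∎

  difference-of-sums : ∀ x x′ y y′ → (x - x′) + (y - y′) ≈ (x + y) - (x′ + y′)
  difference-of-sums x x′ y y′ = begin
    (x - x′) + (y - y′)           ≈⟨ interchange x (- x′) y (- y′) ⟩
    (x + y) + (- x′ - y′)         ≈⟨ +-congˡ (-‿+-comm x′ y′) ⟩
    (x + y) - (x′ + y′)           ∎

  module _ (I : Ideal) where

    private
      _~_ : Carrier → Carrier → Set
      x ~ y = Member I (x - y)

      lift : ∀ {x y} → x ≈ y → x ~ y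
      lift x≈y = respects I (sym (x≈y⇒x∙y⁻¹≈ε x≈y)) (0∈ I)

    -- The quotient keeps the carrier and the operations and only coarsens equality, so elements
    -- pass between a ring and its quotients unchanged.
    quotient : CommutativeRing 0ℓ 0ℓ
    quotient = record
      { Carrier = Carrier ; _≈_ = _~_ ; _+_ = _+_ ; _*_ = _*_ ; -_ = -_ ; 0# = 0# ; 1# = 1#
      ; isCommutativeRing = record
        { isRing = record
          { +-isAbelianGroup = record
            { isGroup = record
              { isMonoid = record
                { isSemigroup = record
                  { isMagma = record
                    { isEquivalence = record
                      { refl  = lift refl
                      ; sym   = λ {x} {y} x~y → respects I (⁻¹-anti-homo‿- x y) (neg-closed I x~y)
                      ; trans = λ {x} {y} {z} x~y y~z → respects I (telescope x y z) (+-closed I x~y y~z)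
                      }
                    ; ∙-cong = λ {x} {x′} {y} {y′} x~x′ y~y′ →
                        respects I (difference-of-sums x x′ y y′) (+-closed I x~x′ y~y′)
                    }
                  ; assoc = λ x y z → lift (+-assoc x y z)
                  }
                ; identity = (λ x → lift (+-identityˡ x)) , (λ x → lift (+-identityʳ x))
                }
              ; inverse = (λ x → lift (-‿inverseˡ x)) , (λ x → lift (-‿inverseʳ x))
              ; ⁻¹-cong = λ {x} {y} x~y → respects I (sym (-‿+-comm x (- y))) (neg-closed I x~y)
              }
            ; comm = λ x y → lift (+-comm x y)
            }
          ; *-cong = λ {x} {x′} {y} {y′} x~x′ y~y′ →
              respects I (difference-of-products x x′ y y′) (+-closed I (absorbs I x y~y′) (absorbs I y′ x~x′))
          ; *-assoc = λ x y z → lift (*-assoc x y z)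
          ; *-identity = (λ x → lift (*-identityˡ x)) , (λ x → lift (*-identityʳ x))
          ; distrib = (λ x y z → lift (distribˡ x y z)) , (λ x y z → lift (distribʳ x y z))
          }
        ; *-comm = λ x y → lift (*-comm x y)
        }
      }

    quotient-≈ : ∀ {x y} → x ≈ y → CommutativeRing._≈_ quotient x y
    quotient-≈ = lift

    quotient-^ : ∀ x m → Exp._^_ (CommutativeRing.semiring quotient) x m ≡ x ^ m
    quotient-^ x zero    = ≡.refl
    quotient-^ x (suc m) = ≡.cong (_*_ x) (quotient-^ x m)

    quotient-× : ∀ m x → Mult._×_ (CommutativeRing.+-monoid quotient) m x ≡ Mult._×_ +-monoid m x
    quotient-× zero    x = ≡.refl
    quotient-× (suc m) x = ≡.cong (_+_ x) (quotient-× m x)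

    adjoin : Carrier → Ideal
    adjoin a = record
      { Member   = λ x → ∃ λ r → Member I (x - r * a)
      ; respects = λ x≈y (r , m) → r , respects I (+-congʳ x≈y) m
      ; 0∈       = 0# , lift (sym (zeroˡ a))
      ; +-closed = λ {x} {y} (r , m) (s , l) → r + s ,
          respects I (trans (difference-of-sums x (r * a) y (s * a)) (+-congˡ (-‿cong (sym (distribʳ a r s))))) (+-closed I m l)
      ; absorbs  = λ t {x} (r , m) → t * r ,
          respects I (trans (x[y-z]≈xy-xz t x (r * a)) (+-congˡ (-‿cong (sym (*-assoc t r a))))) (absorbs I t m)
      }

    ⊆-adjoin : ∀ a {x} → Member I x → Member (adjoin a) x
    ⊆-adjoin a {x} m = 0# , respects I (sym (trans (+-congˡ (trans (-‿cong (zeroˡ a)) -0#≈0#)) (+-identityʳ x))) m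

    ∈-adjoin : ∀ a → Member (adjoin a) a
    ∈-adjoin a = 1# , lift (sym (*-identityˡ a))

  annihilator : Carrier → Ideal
  annihilator b = record
    { Member   = λ x → b * x ≈ 0#
    ; respects = λ x≈y m → trans (*-congˡ (sym x≈y)) m
    ; 0∈       = zeroʳ b
    ; +-closed = λ {x} {y} m l → trans (distribˡ b x y) (trans (+-cong m l) (+-identityˡ 0#))
    ; absorbs  = λ r {x} m → trans (x*yz≈y*xz b r x) (trans (*-congˡ m) (zeroʳ r))
    }

  record Proper : Set₁ where
    field
      ideal   : Ideal
      member? : ∀ x → Dec (Member ideal x)
      1∉      : ¬ Member ideal 1#
    open Ideal ideal public

  open Proper

  -- Maximality in the form in which it is used: every element is zero or invertible in the
  -- quotient.
  Maximal : Proper → Set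
  Maximal J = ∀ x → Member (ideal J) x ⊎ ∃ λ r → Member (ideal J) (1# - r * x)

  module _ {N : ℕ} (e : Fin N → Carrier) (e-surjective : ∀ x → ∃ λ i → x ≈ e i) where

    -- Only finitely many multipliers need to be tried, since r matters only up to `≈` and `e` lists
    -- the ring.
    adjoin-member? : ∀ (J : Proper) a x → Dec (Member (adjoin (ideal J) a) x)
    adjoin-member? J a x = map′
      (λ (i , m) → e i , m)
      (λ (r , m) → let (i , r≈eᵢ) = e-surjective r in
         i , respects (ideal J) (+-congˡ (-‿cong (*-congʳ r≈eᵢ))) m)
      (any? (λ i → member? J (x - e i * a)))

    private
      -- Adjoining, one after the other, every f i that leaves the ideal proper.
      saturate : ∀ {n} (f : Fin n → Carrier) (I : Proper) →
        Σ[ J ∈ Proper ] (∀ {x} → Member (ideal I) x → Member (ideal J) x)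
          × (∀ i → Member (ideal J) (f i) ⊎ ∃ λ r → Member (ideal J) (1# - r * f i))
      saturate {zero}  f I = I , (λ m → m) , λ ()
      saturate {suc n} f I with adjoin-member? I (f zero) 1#
      -- Here 1 lies in I + (f 0), so f 0 is invertible modulo I and remains so modulo every larger
      -- ideal.
      ... | yes (r , m) with saturate (f ∘ suc) I
      ...   | J , I⊆J , max = J , I⊆J , λ { zero → inj₂ (r , I⊆J m) ; (suc i) → max i }
      saturate {suc n} f I | no 1∉I′ with saturate (f ∘ suc) (record
          { ideal = adjoin (ideal I) (f zero) ; member? = adjoin-member? I (f zero) ; 1∉ = 1∉I′ })
      ...   | J , I′⊆J , max = J , I′⊆J ∘ ⊆-adjoin (ideal I) (f zero) ,
                λ { zero → inj₁ (I′⊆J (∈-adjoin (ideal I) (f zero))) ; (suc i) → max i }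

    maximalIdeal : (I : Proper) → Σ[ J ∈ Proper ] (∀ {x} → Member (ideal I) x → Member (ideal J) x) × Maximal J
    maximalIdeal I with saturate e I
    ... | J , I⊆J , max = J , I⊆J , λ x → let (i , x≈eᵢ) = e-surjective x in go x x≈eᵢ (max i)
      where
      go : ∀ x {i} → x ≈ e i → Member (ideal J) (e i) ⊎ (∃ λ r → Member (ideal J) (1# - r * e i)) →
           Member (ideal J) x ⊎ ∃ λ r → Member (ideal J) (1# - r * x)
      go x x≈eᵢ (inj₁ m)       = inj₁ (respects (ideal J) (sym x≈eᵢ) m)
      go x x≈eᵢ (inj₂ (r , m)) = inj₂ (r , respects (ideal J) (+-congˡ (-‿cong (*-congˡ (sym x≈eᵢ)))) m)

-- Polynomials and finite fields

prime∤! : ∀ {p} → Prime p → ∀ {m} → m ℕ.< p → p ℕ.∤ (m !)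
prime∤! {p} pr {zero}  _    p∣1 = contradiction (∣⇒≤ p∣1) (ℕ.<⇒≱ (ℕ.nonTrivial⇒n>1 p))
  where instance _ = prime⇒nonTrivial pr
prime∤! {p} pr {suc m} m<p p∣ with euclidsLemma (suc m) (m !) pr p∣
... | inj₁ p∣m  = contradiction (∣⇒≤ p∣m) (ℕ.<⇒≱ m<p)
... | inj₂ p∣m! = prime∤! pr (ℕ.<⇒≤ m<p) p∣m!

nCk*k![n∸k]!≡n! : ∀ {n k} → k ℕ.≤ n → (n C k) ℕ.* (k ! ℕ.* (n ℕ.∸ k) !) ≡ n !
nCk*k![n∸k]!≡n! {n} {k} k≤n = ≡.trans
  (≡.cong (ℕ._* (k ! ℕ.* (n ℕ.∸ k) !)) (nCk≡n!/k![n-k]! k≤n))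
  (m/n*n≡m (k![n∸k]!∣n! k≤n))
  where instance _ = (k ℕ.!* (n ℕ.∸ k) !≢0)

-- p divides p! = (p C k) k! (p - k)!, while both factorials are products of numbers less than p.
prime∣binomial : ∀ {p} → Prime p → ∀ {k} → 0 ℕ.< k → k ℕ.< p → p ℕ.∣ p C k
prime∣binomial {zero}  pr = ⊥-elim (¬prime[0] pr)
prime∣binomial {p@(suc m)} pr {k} 0<k k<p with euclidsLemma (p C k) (k ! ℕ.* (p ℕ.∸ k) !) pr
    (≡.subst (p ℕ.∣_) (≡.sym (nCk*k![n∸k]!≡n! (ℕ.<⇒≤ k<p))) (m∣m*n (m !)))
... | inj₁ p∣C = p∣C
... | inj₂ p∣kk with euclidsLemma (k !) ((p ℕ.∸ k) !) pr p∣kk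
...   | inj₁ p∣k! = ⊥-elim (prime∤! pr k<p p∣k!)
...   | inj₂ p∣!  = ⊥-elim (prime∤! pr (ℕ.∸-monoʳ-< 0<k (ℕ.<⇒≤ k<p)) p∣!)

_HasCharacteristic_ : CommutativeRing 0ℓ 0ℓ → ℕ → Set
R HasCharacteristic p = Mult._×_ +-monoid p 1# ≈ 0#
  where open CommutativeRing R

module Characteristic (R : CommutativeRing 0ℓ 0ℓ) {p : ℕ} (pr : Prime p) (p×1≈0 : R HasCharacteristic p) where

  open CommutativeRing R hiding (zero)
  open import Algebra.Properties.Ring ring
  open import Algebra.Properties.Semiring.Mult semiring
  open import Algebra.Properties.Semiring.Exp semiring
  open import Algebra.Properties.Semiring.Sum semiring
  open import Algebra.Properties.CommutativeSemiring.Binomial commutativeSemiring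
  open import Relation.Binary.Reasoning.Setoid setoid

  p×≈0 : ∀ x → p × x ≈ 0#
  p×≈0 x = begin
    p × x          ≈⟨ ×-congʳ p (*-identityˡ x) ⟨
    p × (1# * x)   ≈⟨ ×-assoc-* p 1# x ⟨
    (p × 1#) * x   ≈⟨ *-congʳ p×1≈0 ⟩
    0# * x         ≈⟨ zeroˡ x ⟩
    0#             ∎

  ∣⇒×≈0 : ∀ {n} → p ℕ.∣ n → ∀ x → n × x ≈ 0#
  ∣⇒×≈0 (ℕ.divides m ≡.refl) x = trans (×-congˡ (ℕ.*-comm m p)) (trans (sym (×-assocˡ x p m)) (p×≈0 (m × x)))

  0^p≈0 : 0# ^ p ≈ 0#
  0^p≈0 = positive (ℕ.>-nonZero⁻¹ p)
    where
    instance _ = prime⇒nonZero pr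
    positive : ∀ {n} → 0 ℕ.< n → 0# ^ n ≈ 0#
    positive {suc n} _ = zeroˡ (0# ^ n)

  -- In the binomial expansion all coefficients but the outer two are divisible by p, so the inner
  -- terms vanish.
  ^p-homo-+ : ∀ x y → (x + y) ^ p ≈ x ^ p + y ^ p
  ^p-homo-+ x y = trans (theorem p x y) (go p ≡.refl)
    where
    middle : ∀ {k} → 0 ℕ.< k → k ℕ.< p → ∀ z → (p C k) × z ≈ 0#
    middle 0<k k<p = ∣⇒×≈0 (prime∣binomial pr 0<k k<p)
    go : ∀ m → m ≡ p → binomialExpansion x y m ≈ x ^ m + y ^ m
    go zero    0≡p = ⊥-elim (¬prime[0] (≡.subst Prime (≡.sym 0≡p) pr))
    go (suc m) ≡.refl = begin
      t zero + sum (λ i → t (suc i))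
        ≈⟨ +-congˡ (sum-init-last (λ i → t (suc i))) ⟩
      t zero + (sum (λ i → t (suc (inject₁ i))) + t (suc (fromℕ m)))
        ≈⟨ +-cong first (+-cong (trans (sum-cong-≋ mid) (sum-replicate-zero m)) last′) ⟩
      y ^ suc m + (0# + x ^ suc m)
        ≈⟨ +-congˡ (+-identityˡ _) ⟩
      y ^ suc m + x ^ suc m
        ≈⟨ +-comm _ _ ⟩
      x ^ suc m + y ^ suc m ∎
      where
      t : Fin (suc (suc m)) → Carrier
      t = binomialTerm x y (suc m)
      first : t zero ≈ y ^ suc m
      first = trans (×-homo-1 _) (*-identityˡ _)
      mid : ∀ i → t (suc (inject₁ i)) ≈ 0#
      mid i = middle (s≤s z≤n) (s≤s (≡.subst (ℕ._< m) (≡.sym (toℕ-inject₁ i)) (toℕ<n i))) _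
      last′ : t (suc (fromℕ m)) ≈ x ^ suc m
      last′ rewrite toℕ-fromℕ m | nCn≡1 (suc m) | ℕ.n∸n≡0 m = trans (×-homo-1 _) (*-identityʳ _)

  -- Additivity gives (-x)^p + x^p = 0^p = 0; this avoids distinguishing p = 2 from odd p.
  ^p-homo-neg : ∀ x → (- x) ^ p ≈ - (x ^ p)
  ^p-homo-neg x = +-inverseˡ-unique ((- x) ^ p) (x ^ p) (begin
    (- x) ^ p + x ^ p   ≈⟨ ^p-homo-+ (- x) x ⟨
    (- x + x) ^ p       ≈⟨ ^-congˡ p (-‿inverseˡ x) ⟩
    0# ^ p              ≈⟨ 0^p≈0 ⟩
    0#                  ∎)

  1^n≈1 : ∀ n → 1# ^ n ≈ 1#
  1^n≈1 zero    = refl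
  1^n≈1 (suc n) = trans (*-identityˡ _) (1^n≈1 n)

  -- Fermat's little theorem for the prime field, by induction from additivity of the p-th power.
  ×1^p : ∀ n → (n × 1#) ^ p ≈ n × 1#
  ×1^p zero    = 0^p≈0
  ×1^p (suc n) = trans (^p-homo-+ 1# (n × 1#)) (+-cong (1^n≈1 p) (×1^p n))

  ^-p^suc : ∀ x e → x ^ (p ℕ.^ suc e) ≈ (x ^ p) ^ (p ℕ.^ e)
  ^-p^suc x e = sym (^-assocʳ x p (p ℕ.^ e))

  ^pᵉ-homo-+ : ∀ e x y → (x + y) ^ (p ℕ.^ e) ≈ x ^ (p ℕ.^ e) + y ^ (p ℕ.^ e)
  ^pᵉ-homo-+ zero    x y = trans (*-identityʳ _) (sym (+-cong (*-identityʳ x) (*-identityʳ y)))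
  ^pᵉ-homo-+ (suc e) x y = begin
    (x + y) ^ (p ℕ.^ suc e)                        ≈⟨ ^-p^suc (x + y) e ⟩
    ((x + y) ^ p) ^ (p ℕ.^ e)                      ≈⟨ ^-congˡ (p ℕ.^ e) (^p-homo-+ x y) ⟩
    (x ^ p + y ^ p) ^ (p ℕ.^ e)                    ≈⟨ ^pᵉ-homo-+ e (x ^ p) (y ^ p) ⟩
    (x ^ p) ^ (p ℕ.^ e) + (y ^ p) ^ (p ℕ.^ e)      ≈⟨ +-cong (^-p^suc x e) (^-p^suc y e) ⟨
    x ^ (p ℕ.^ suc e) + y ^ (p ℕ.^ suc e)          ∎

  ^pᵉ-homo-neg : ∀ e x → (- x) ^ (p ℕ.^ e) ≈ - (x ^ (p ℕ.^ e))
  ^pᵉ-homo-neg zero    x = trans (*-identityʳ _) (-‿cong (sym (*-identityʳ x)))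
  ^pᵉ-homo-neg (suc e) x = begin
    (- x) ^ (p ℕ.^ suc e)       ≈⟨ ^-p^suc (- x) e ⟩
    ((- x) ^ p) ^ (p ℕ.^ e)     ≈⟨ ^-congˡ (p ℕ.^ e) (^p-homo-neg x) ⟩
    (- (x ^ p)) ^ (p ℕ.^ e)     ≈⟨ ^pᵉ-homo-neg e (x ^ p) ⟩
    - ((x ^ p) ^ (p ℕ.^ e))     ≈⟨ -‿cong (^-p^suc x e) ⟨
    - (x ^ (p ℕ.^ suc e))       ∎

  0^pᵉ≈0 : ∀ e → 0# ^ (p ℕ.^ e) ≈ 0#
  0^pᵉ≈0 zero    = *-identityʳ 0#
  0^pᵉ≈0 (suc e) = trans (^-p^suc 0# e) (trans (^-congˡ (p ℕ.^ e) 0^p≈0) (0^pᵉ≈0 e))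

module Polynomials (R : CommutativeRing 0ℓ 0ℓ) where

  open CommutativeRing R hiding (zero)
  open import Algebra.Properties.Ring ring
  open import Algebra.Properties.Semiring.Exp semiring
  open import Algebra.Properties.CommutativeSemigroup +-commutativeSemigroup using (interchange)
  open import Relation.Binary.Reasoning.Setoid setoid

  -- A polynomial is its coefficient vector, constant term first; length n means degree less than n.
  eval : ∀ {n} → (Fin n → Carrier) → Carrier → Carrier
  eval {zero}  c t = 0#
  eval {suc n} c t = c zero + t * eval (c ∘ suc) t

  eval-cong : ∀ {n} {c c′ : Fin n → Carrier} {t t′} → (∀ i → c i ≈ c′ i) → t ≈ t′ → eval c t ≈ eval c′ t′
  eval-cong {zero}  c≈ t≈ = refl
  eval-cong {suc n} c≈ t≈ = +-cong (c≈ zero) (*-cong t≈ (eval-cong (c≈ ∘ suc) t≈))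

  eval-+ : ∀ {n} (c c′ : Fin n → Carrier) t → eval (λ i → c i + c′ i) t ≈ eval c t + eval c′ t
  eval-+ {zero}  c c′ t = sym (+-identityˡ 0#)
  eval-+ {suc n} c c′ t = begin
    (c zero + c′ zero) + t * eval (λ i → c (suc i) + c′ (suc i)) t
      ≈⟨ +-congˡ (trans (*-congˡ (eval-+ (c ∘ suc) (c′ ∘ suc) t)) (distribˡ t _ _)) ⟩
    (c zero + c′ zero) + (t * eval (c ∘ suc) t + t * eval (c′ ∘ suc) t)
      ≈⟨ interchange _ _ _ _ ⟩
    (c zero + t * eval (c ∘ suc) t) + (c′ zero + t * eval (c′ ∘ suc) t) ∎

  eval-neg : ∀ {n} (c : Fin n → Carrier) t → eval (λ i → - c i) t ≈ - eval c t
  eval-neg {zero}  c t = sym -0#≈0#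
  eval-neg {suc n} c t = begin
    - c zero + t * eval (λ i → - c (suc i)) t  ≈⟨ +-congˡ (*-congˡ (eval-neg (c ∘ suc) t)) ⟩
    - c zero + t * - eval (c ∘ suc) t          ≈⟨ +-congˡ (-‿distribʳ-* t _) ⟨
    - c zero - t * eval (c ∘ suc) t            ≈⟨ -‿+-comm _ _ ⟩
    - (c zero + t * eval (c ∘ suc) t)          ∎

  monomial : ∀ n → Fin (suc n) → Carrier
  monomial zero    _       = 1#
  monomial (suc n) zero    = 0#
  monomial (suc n) (suc i) = monomial n i

  eval-monomial : ∀ n t → eval (monomial n) t ≈ t ^ n
  eval-monomial zero    t = trans (+-congˡ (zeroʳ t)) (+-identityʳ 1#)
  eval-monomial (suc n) t = trans (+-identityˡ _) (*-congˡ (eval-monomial n t))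

  -- The quotient of c by Y - a (Horner's scheme).
  quotient : ∀ {n} → (Fin (suc n) → Carrier) → Carrier → Fin n → Carrier
  quotient {suc n} c a zero    = eval (c ∘ suc) a
  quotient {suc n} c a (suc i) = quotient (c ∘ suc) a i

  -- Division by Y - a with remainder. The induction rewrites t A as a A + (t - a) A, where A is the
  -- value of the tail at a.
  eval-quotient : ∀ {n} (c : Fin (suc n) → Carrier) a t →
                  eval c t ≈ eval c a + (t - a) * eval (quotient c a) t
  eval-quotient {zero} c a t = begin
    c zero + t * 0#                    ≈⟨ +-congˡ (trans (zeroʳ t) (sym (zeroʳ a))) ⟩
    c zero + a * 0#                    ≈⟨ +-identityʳ _ ⟨
    (c zero + a * 0#) + 0#             ≈⟨ +-congˡ (zeroʳ (t - a)) ⟨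
    (c zero + a * 0#) + (t - a) * 0#   ∎
  eval-quotient {suc n} c a t = begin
    c₀ + t * eval c′ t                              ≈⟨ +-congˡ (*-congˡ (eval-quotient c′ a t)) ⟩
    c₀ + t * (A + (t - a) * Q)                      ≈⟨ +-congˡ (trans (distribˡ t A _) (+-cong tA t[t-a]Q)) ⟩
    c₀ + ((a * A + (t - a) * A) + (t - a) * (t * Q)) ≈⟨ +-congˡ (trans (+-assoc _ _ _) (+-congˡ (sym (distribˡ (t - a) A (t * Q))))) ⟩
    c₀ + (a * A + (t - a) * (A + t * Q))            ≈⟨ +-assoc c₀ (a * A) _ ⟨
    (c₀ + a * A) + (t - a) * (A + t * Q)            ∎
    where
    c₀ = c zero
    c′ = c ∘ suc
    A = eval c′ a
    Q = eval (quotient c′ a) t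
    tA : t * A ≈ a * A + (t - a) * A
    tA = begin
      t * A                      ≈⟨ +-identityˡ (t * A) ⟨
      0# + t * A                 ≈⟨ +-congʳ (-‿inverseʳ (a * A)) ⟨
      (a * A - a * A) + t * A    ≈⟨ +-assoc _ _ _ ⟩
      a * A + (- (a * A) + t * A) ≈⟨ +-congˡ (+-comm _ _) ⟩
      a * A + (t * A - a * A)    ≈⟨ +-congˡ ([y-z]x≈yx-zx A t a) ⟨
      a * A + (t - a) * A        ∎
    t[t-a]Q : t * ((t - a) * Q) ≈ (t - a) * (t * Q)
    t[t-a]Q = trans (sym (*-assoc t (t - a) Q)) (trans (*-congʳ (*-comm t (t - a))) (*-assoc (t - a) t Q))

  -- The first coefficient of the quotient is the value at a of the tail of `c`, so the tail again
  -- has zero quotient and zero remainder. Then c(a) = 0 forces the constant term to vanish.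
  quotient≈0⇒≈0 : ∀ {n} (c : Fin (suc n) → Carrier) a → (∀ i → quotient c a i ≈ 0#) → eval c a ≈ 0# → ∀ i → c i ≈ 0#
  quotient≈0⇒≈0 {zero} c a _ c[a]≈0 zero = trans (sym (trans (+-congˡ (zeroʳ a)) (+-identityʳ (c zero)))) c[a]≈0
  quotient≈0⇒≈0 {suc n} c a q≈0 c[a]≈0 zero = begin
    c zero                              ≈⟨ +-identityʳ (c zero) ⟨
    c zero + 0#                         ≈⟨ +-congˡ (trans (*-congˡ (q≈0 zero)) (zeroʳ a)) ⟨
    c zero + a * eval (c ∘ suc) a       ≈⟨ c[a]≈0 ⟩
    0#                                  ∎
  quotient≈0⇒≈0 {suc n} c a q≈0 c[a]≈0 (suc i) = quotient≈0⇒≈0 (c ∘ suc) a (q≈0 ∘ suc) (q≈0 zero) i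

  module _ (integral : ∀ {x y} → x * y ≈ 0# → x ≈ 0# ⊎ y ≈ 0#) where

    -- After division by Y - r 0, integrality makes the remaining roots, all different from r 0,
    -- roots of the quotient, which is zero by induction.
    tooManyRoots⇒≈0 : ∀ {n} (c r : Fin n → Carrier) → (∀ {i j} → r i ≈ r j → i ≡ j) →
                      (∀ i → eval c (r i) ≈ 0#) → ∀ i → c i ≈ 0#
    tooManyRoots⇒≈0 {suc n} c r distinct root =
      quotient≈0⇒≈0 c a (tooManyRoots⇒≈0 (quotient c a) (r ∘ suc) (suc-injective ∘ distinct) root′) (root zero)
      where
      a = r zero
      root′ : ∀ i → eval (quotient c a) (r (suc i)) ≈ 0#
      root′ i with integral (begin
          (r (suc i) - a) * eval (quotient c a) (r (suc i))              ≈⟨ +-identityˡ _ ⟨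
          0# + (r (suc i) - a) * eval (quotient c a) (r (suc i))         ≈⟨ +-congʳ (root zero) ⟨
          eval c a + (r (suc i) - a) * eval (quotient c a) (r (suc i))   ≈⟨ eval-quotient c a (r (suc i)) ⟨
          eval c (r (suc i))                                             ≈⟨ root (suc i) ⟩
          0#                                                             ∎)
      ... | inj₂ e = e
      ... | inj₁ e with () ← distinct (x∙y⁻¹≈ε⇒x≈y (r (suc i)) a e)

-- A field of characteristic p in which t^(p^d) = t for all t, with an element x
-- lying in no proper subfield.
record FrobeniusField (K : CommutativeRing 0ℓ 0ℓ) (p d : ℕ) : Set where
  open CommutativeRing K hiding (zero)
  open Exp semiring using (_^_)
  field
    _≈?_       : ∀ x y → Dec (x ≈ y)
    1≉0        : ¬ 1# ≈ 0#
    invertible : ∀ x → x ≈ 0# ⊎ ∃ λ r → 1# ≈ r * x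
    p×1≈0      : K HasCharacteristic p
    fermat     : ∀ t → t ^ (p ℕ.^ d) ≈ t
    x          : Carrier
    generic    : ∀ {e} → 1 ℕ.≤ e → e ℕ.< d → ¬ x ^ (p ℕ.^ e) ≈ x

module FiniteField {K : CommutativeRing 0ℓ 0ℓ} {p : ℕ} (pr : Prime p) {d : ℕ} (1≤d : 1 ℕ.≤ d)
                   (frobeniusField : FrobeniusField K p d) where

  open CommutativeRing K hiding (zero)
  open FrobeniusField frobeniusField
  open Exp semiring
  open import Algebra.Properties.Semiring.Mult semiring
  open import Algebra.Properties.CommutativeSemiring.Exp commutativeSemiring using (^-distrib-*)
  open import Algebra.Properties.Ring ring
  open import Relation.Binary.Reasoning.Setoid setoid
  open Characteristic K pr p×1≈0
  open Polynomials K

  integral : ∀ {a b} → a * b ≈ 0# → a ≈ 0# ⊎ b ≈ 0#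
  integral {a} {b} ab≈0 with invertible a
  ... | inj₁ a≈0       = inj₁ a≈0
  ... | inj₂ (r , 1≈ra) = inj₂ (begin
    b            ≈⟨ *-identityˡ b ⟨
    1# * b       ≈⟨ *-congʳ 1≈ra ⟩
    (r * a) * b  ≈⟨ *-assoc r a b ⟩
    r * (a * b)  ≈⟨ *-congˡ ab≈0 ⟩
    r * 0#       ≈⟨ zeroʳ r ⟩
    0#           ∎)

  private
    instance
      p≢0 : ℕ.NonZero p
      p≢0 = prime⇒nonZero pr

    Frobenius-fixed : Carrier → Set
    Frobenius-fixed c = c ^ p ≈ c

    -- The p-th power is a ring endomorphism, so it moves from the value to the argument when it
    -- fixes the coefficients.
    eval-^p : ∀ {n} (c : Fin n → Carrier) t → (∀ i → Frobenius-fixed (c i)) → eval c t ^ p ≈ eval c (t ^ p)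
    eval-^p {zero}  c t fixed = 0^p≈0
    eval-^p {suc n} c t fixed = begin
      (c zero + t * eval (c ∘ suc) t) ^ p        ≈⟨ ^p-homo-+ _ _ ⟩
      c zero ^ p + (t * eval (c ∘ suc) t) ^ p    ≈⟨ +-cong (fixed zero) (^-distrib-* t _ p) ⟩
      c zero + t ^ p * eval (c ∘ suc) t ^ p      ≈⟨ +-congˡ (*-congˡ (eval-^p (c ∘ suc) t (fixed ∘ suc))) ⟩
      c zero + t ^ p * eval (c ∘ suc) (t ^ p)    ∎

    -- Iterates `eval-^p`: from f(t) = 0 follows f(t^p) = f(t)^p = 0.
    conjugate-root : ∀ {n} (c : Fin n → Carrier) t → (∀ i → Frobenius-fixed (c i)) →
                     eval c t ≈ 0# → ∀ e → eval c (t ^ (p ℕ.^ e)) ≈ 0#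
    conjugate-root c t fixed root zero    = trans (eval-cong {c = c} {c} (λ _ → refl) (*-identityʳ t)) root
    conjugate-root c t fixed root (suc e) = trans (eval-cong {c = c} {c} (λ _ → refl) (^-p^suc t e))
      (conjugate-root c (t ^ p) fixed (trans (sym (eval-^p c t fixed)) (trans (^-congˡ p root) 0^p≈0)) e)

    -- If x^(p^i) = x^(p^j) with i < j < d, raising to the power p^(d-i) gives x = x^(p^(j-i)).
    conjugates-≉ : ∀ {i j} → i ℕ.< j → j ℕ.< d → ¬ x ^ (p ℕ.^ i) ≈ x ^ (p ℕ.^ j)
    conjugates-≉ {i} {j} i<j j<d eq = generic (ℕ.m<n⇒0<n∸m i<j) (ℕ.≤-<-trans (ℕ.m∸n≤m j i) j<d) (begin
      x ^ (p ℕ.^ (j ℕ.∸ i))                              ≈⟨ ^-congˡ (p ℕ.^ (j ℕ.∸ i)) (fermat x) ⟨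
      (x ^ (p ℕ.^ d)) ^ (p ℕ.^ (j ℕ.∸ i))                ≈⟨ ^-^ d (j ℕ.∸ i) ⟩
      x ^ (p ℕ.^ (d ℕ.+ (j ℕ.∸ i)))                      ≡⟨ ≡.cong (λ e → x ^ (p ℕ.^ e)) exponent ⟩
      x ^ (p ℕ.^ (j ℕ.+ (d ℕ.∸ i)))                      ≈⟨ ^-^ j (d ℕ.∸ i) ⟨
      (x ^ (p ℕ.^ j)) ^ (p ℕ.^ (d ℕ.∸ i))                ≈⟨ ^-congˡ (p ℕ.^ (d ℕ.∸ i)) eq ⟨
      (x ^ (p ℕ.^ i)) ^ (p ℕ.^ (d ℕ.∸ i))                ≈⟨ ^-^ i (d ℕ.∸ i) ⟩
      x ^ (p ℕ.^ (i ℕ.+ (d ℕ.∸ i)))                      ≡⟨ ≡.cong (λ e → x ^ (p ℕ.^ e)) (ℕ.m+[n∸m]≡n i≤d) ⟩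
      x ^ (p ℕ.^ d)                                      ≈⟨ fermat x ⟩
      x                                                  ∎)
      where
      i≤j = ℕ.<⇒≤ i<j
      i≤d = ℕ.≤-trans i≤j (ℕ.<⇒≤ j<d)
      ^-^ : ∀ a b → (x ^ (p ℕ.^ a)) ^ (p ℕ.^ b) ≈ x ^ (p ℕ.^ (a ℕ.+ b))
      ^-^ a b = trans (^-assocʳ x (p ℕ.^ a) (p ℕ.^ b)) (^-congʳ x (≡.sym (ℕ.^-distribˡ-+-* p a b)))
      exponent : d ℕ.+ (j ℕ.∸ i) ≡ j ℕ.+ (d ℕ.∸ i)
      exponent = ≡.trans (≡.sym (ℕ.+-∸-assoc d i≤j)) (≡.trans (≡.cong (ℕ._∸ i) (ℕ.+-comm d j)) (ℕ.+-∸-assoc j i≤d))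

    conjugates-distinct : ∀ {i j : Fin d} → x ^ (p ℕ.^ toℕ i) ≈ x ^ (p ℕ.^ toℕ j) → i ≡ j
    conjugates-distinct {i} {j} eq with ℕ.<-cmp (toℕ i) (toℕ j)
    ... | tri< i<j _ _ = contradiction eq (conjugates-≉ i<j (toℕ<n j))
    ... | tri≈ _ i≡j _ = toℕ-injective i≡j
    ... | tri> _ _ j<i = contradiction (sym eq) (conjugates-≉ j<i (toℕ<n i))

    -- As m is coprime to p, 1 is a difference of a multiple of p and a multiple of m. If m times 1
    -- vanished, both multiples would vanish, and so would 1.
    ×1≉0 : ∀ {m} → 0 ℕ.< m → m ℕ.< p → ¬ m × 1# ≈ 0#
    ×1≉0 {m} 0<m m<p m×1≈0 = 1≉0 (bézout (coprime-Bézout (prime⇒coprime pr m<p)))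
      where
      instance _ = ℕ.>-nonZero 0<m
      kill : ∀ k n → n × 1# ≈ 0# → (k ℕ.* n) × 1# ≈ 0#
      kill k n e = trans (×1-homo-* k n) (trans (*-congˡ e) (zeroʳ _))
      bézout : Bézout.Identity 1 p m → 1# ≈ 0#
      bézout (Bézout.+- a b eq) = begin
        1#                              ≈⟨ trans (+-congˡ (kill b m m×1≈0)) (+-identityʳ 1#) ⟨
        (1 ℕ.+ b ℕ.* m) × 1#            ≡⟨ ≡.cong (_× 1#) eq ⟩
        (a ℕ.* p) × 1#                  ≈⟨ kill a p p×1≈0 ⟩
        0#                              ∎
      bézout (Bézout.-+ a b eq) = begin
        1#                              ≈⟨ trans (+-congˡ (kill a p p×1≈0)) (+-identityʳ 1#) ⟨
        (1 ℕ.+ a ℕ.* p) × 1#            ≡⟨ ≡.cong (_× 1#) eq ⟩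
        (b ℕ.* m) × 1#                  ≈⟨ kill b m m×1≈0 ⟩
        0#                              ∎

    ×1-≉ : ∀ {m n} → m ℕ.< n → n ℕ.< p → ¬ m × 1# ≈ n × 1#
    ×1-≉ {m} {n} m<n n<p eq = ×1≉0 (ℕ.m<n⇒0<n∸m m<n) (ℕ.≤-<-trans (ℕ.m∸n≤m n m) n<p)
      (+-identityʳ-unique (m × 1#) ((n ℕ.∸ m) × 1#) (begin
        m × 1# + (n ℕ.∸ m) × 1#    ≈⟨ ×-homo-+ 1# m (n ℕ.∸ m) ⟨
        (m ℕ.+ (n ℕ.∸ m)) × 1#     ≡⟨ ≡.cong (_× 1#) (ℕ.m+[n∸m]≡n (ℕ.<⇒≤ m<n)) ⟩
        n × 1#                     ≈⟨ eq ⟨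
        m × 1#                     ∎))

    scalar : Fin p → Carrier
    scalar i = toℕ i × 1#

    scalar-injective : ∀ {i j} → scalar i ≈ scalar j → i ≡ j
    scalar-injective {i} {j} eq with ℕ.<-cmp (toℕ i) (toℕ j)
    ... | tri< i<j _ _ = contradiction eq (×1-≉ i<j (toℕ<n j))
    ... | tri≈ _ i≡j _ = toℕ-injective i≡j
    ... | tri> _ _ j<i = contradiction (sym eq) (×1-≉ j<i (toℕ<n i))

    combination : (Fin d → Fin p) → Carrier
    combination c = eval (scalar ∘ c) x

    -- The difference polynomial `g` has coefficients in the prime field, degree less than d and the
    -- root x. It then vanishes at all d conjugates of x, which are distinct, and must be zero.
    combination-injective : ∀ {c c′} → combination c ≈ combination c′ → ∀ i → c i ≡ c′ i
    combination-injective {c} {c′} eq i = scalar-injective (x∙y⁻¹≈ε⇒x≈y _ _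
      (tooManyRoots⇒≈0 integral g (λ e → x ^ (p ℕ.^ toℕ e)) conjugates-distinct
        (λ e → conjugate-root g x fixed root (toℕ e)) i))
      where
      g : Fin d → Carrier
      g i = scalar (c i) - scalar (c′ i)
      fixed : ∀ i → Frobenius-fixed (g i)
      fixed i = trans (^p-homo-+ _ _) (+-cong (×1^p (toℕ (c i))) (trans (^p-homo-neg _) (-‿cong (×1^p (toℕ (c′ i))))))
      root : eval g x ≈ 0#
      root = trans (eval-+ (scalar ∘ c) (λ i → - scalar (c′ i)) x)
        (trans (+-congˡ (eval-neg (scalar ∘ c′) x)) (x≈y⇒x∙y⁻¹≈ε eq))

  element : Fin (p ℕ.^ d) → Carrier
  element = combination ∘ finToFun

  element-injective : ∀ {i j} → element i ≈ element j → i ≡ j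
  element-injective eq = finToFun-injective (combination-injective eq)

  private
    2≤p^d : 2 ℕ.≤ p ℕ.^ d
    2≤p^d = ℕ.≤-trans (ℕ.nonTrivial⇒n>1 p {{prime⇒nonTrivial pr}})
      (ℕ.≤-trans (ℕ.≤-reflexive (≡.sym (ℕ.*-identityʳ p))) (ℕ.^-monoʳ-≤ p 1≤d))

    -- Otherwise t and the p^d elements above are p^d + 1 roots of Y^(p^d) - Y.
    missed : ∀ {m} → m ≡ p ℕ.^ d → (f : Fin m → Carrier) → (∀ {i j} → f i ≈ f j → i ≡ j) →
             ∀ t → ¬ (∀ i → ¬ f i ≈ t)
    missed {zero} m≡ f _ t _ with () ← ≡.subst (2 ℕ.≤_) (≡.sym m≡) 2≤p^d
    missed {suc zero} m≡ f _ t _ with s≤s () ← ≡.subst (2 ℕ.≤_) (≡.sym m≡) 2≤p^d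
    missed {suc (suc n)} m≡ f f-injective t ∉ =
      -- The n + 3 coefficients `c` are those of Y^(n+2) - Y with n + 2 = p^d. The coefficient of Y
      -- is -1, and its vanishing gives 1 = 0. The cases p^d < 2 were excluded so that Y and Y^(n+2)
      -- differ.
      1≉0 (trans (sym (-‿involutive 1#)) (trans (-‿cong (tooManyRoots⇒≈0 integral c r distinct root (suc zero))) -0#≈0#))
      where
      c : Fin (suc (suc (suc n))) → Carrier
      c zero          = 0#
      c (suc zero)    = - 1#
      c (suc (suc i)) = monomial n i
      r : Fin (suc (suc (suc n))) → Carrier
      r zero    = t
      r (suc i) = f i
      distinct : ∀ {i j} → r i ≈ r j → i ≡ j
      distinct {zero}  {zero}  _ = ≡.refl
      distinct {zero}  {suc j} e = contradiction (sym e) (∉ j)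
      distinct {suc i} {zero}  e = contradiction e (∉ i)
      distinct {suc i} {suc j} e = ≡.cong suc (f-injective e)
      root : ∀ i → eval c (r i) ≈ 0#
      root i = begin
        0# + y * (- 1# + y * eval (monomial n) y)   ≈⟨ +-identityˡ _ ⟩
        y * (- 1# + y * eval (monomial n) y)        ≈⟨ *-congˡ (+-congˡ (*-congˡ (eval-monomial n y))) ⟩
        y * (- 1# + y ^ suc n)                      ≈⟨ distribˡ y (- 1#) (y ^ suc n) ⟩
        y * - 1# + y ^ suc (suc n)                  ≈⟨ +-cong (trans (sym (-‿distribʳ-* y 1#)) (-‿cong (*-identityʳ y)))
                                                         (trans (^-congʳ y m≡) (fermat y)) ⟩
        - y + y                                     ≈⟨ -‿inverseˡ y ⟩
        0#                                          ∎
        where y = r i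

  element-surjective : ∀ t → ∃ λ i → element i ≈ t
  element-surjective t with any? (λ i → element i ≈? t)
  ... | yes found = found
  ... | no ¬found = contradiction (λ i e → ¬found (i , e)) (missed ≡.refl element element-injective t)

-- The ring ℤ[Y]/(Y^q − Y) with q = n + 2, an element being its vector of coefficients.
module CyclicRing (n : ℕ) where

  open import Data.Integer.Base using (_+_; _*_; -_; _-_)
  open import Relation.Binary.PropositionalEquality
  open IntegerSums

  q : ℕ
  q = suc (suc n)

  Element : Set
  Element = Fin q → ℤ

  infix 4 _≗ₑ_
  _≗ₑ_ : Element → Element → Set
  u ≗ₑ v = ∀ k → u k ≡ v k

  -- Multiplication by Y.
  shift : Element → Element
  shift v zero          = + 0
  shift v (suc zero)    = v zero + v (fromℕ (suc n))
  shift v (suc (suc k)) = v (suc (inject₁ k))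

  shifts : ℕ → Element → Element
  shifts zero    v = v
  shifts (suc i) v = shift (shifts i v)

  one : Element
  one = δ zero

  infixl 7 _∙_
  -- Since `shifts i` multiplies by Y^i, this is the usual product with the reduction Y^q = Y built
  -- in.
  _∙_ : Element → Element → Element
  (u ∙ v) k = ∑[ i < q ] (u i * shifts (toℕ i) v k)

  shift-cong : ∀ {u v} → u ≗ₑ v → shift u ≗ₑ shift v
  shift-cong u≗v zero          = refl
  shift-cong u≗v (suc zero)    = cong₂ _+_ (u≗v zero) (u≗v (fromℕ (suc n)))
  shift-cong u≗v (suc (suc k)) = u≗v (suc (inject₁ k))

  shifts-cong : ∀ i {u v} → u ≗ₑ v → shifts i u ≗ₑ shifts i v
  shifts-cong zero    u≗v = u≗v
  shifts-cong (suc i) u≗v = shift-cong (shifts-cong i u≗v)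

  shift-linear : ∀ {m} (c : Fin m → ℤ) (v : Fin m → Element) →
    shift (λ k → ∑[ i < m ] (c i * v i k)) ≗ₑ λ k → ∑[ i < m ] (c i * shift (v i) k)
  shift-linear {m} c v zero          = sym (trans (∑-cong (λ i → ℤ.*-zeroʳ (c i))) (sum-replicate-zero m))
  shift-linear c v (suc zero)    = sym (trans
    (∑-cong (λ i → ℤ.*-distribˡ-+ (c i) (v i zero) (v i (fromℕ (suc n)))))
    (∑-distrib-+ (λ i → c i * v i zero) (λ i → c i * v i (fromℕ (suc n)))))
  shift-linear c v (suc (suc k)) = refl

  shifts-linear : ∀ j {m} (c : Fin m → ℤ) (v : Fin m → Element) →
    shifts j (λ k → ∑[ i < m ] (c i * v i k)) ≗ₑ λ k → ∑[ i < m ] (c i * shifts j (v i) k)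
  shifts-linear zero    c v k = refl
  shifts-linear (suc j) c v k = trans (shift-cong (shifts-linear j c v) k) (shift-linear c (λ i → shifts j (v i)) k)

  shifts-+ : ∀ i j v → shifts i (shifts j v) ≡ shifts (i ℕ.+ j) v
  shifts-+ zero    j v = refl
  shifts-+ (suc i) j v = cong shift (shifts-+ i j v)

  -- Below Y^q nothing has wrapped around: in the step to i + 1 < q the top coefficient of Y^i is
  -- still 0.
  shifts-one : ∀ i → i ℕ.< q → ∀ k → shifts i one k ≡ ⟦ does (i ℕ.≟ toℕ k) ⟧
  shifts-one zero    _   k             = ⟦⟧-cong (zero ≟ k) (0 ℕ.≟ toℕ k) (cong toℕ) toℕ-injective
  shifts-one (suc i) i<q zero          = refl
  shifts-one (suc i) i<q (suc zero)    = begin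
    shifts i one zero + shifts i one (fromℕ (suc n))
      ≡⟨ cong₂ _+_ (shifts-one i (ℕ.<⇒≤ i<q) zero) (trans (shifts-one i (ℕ.<⇒≤ i<q) (fromℕ (suc n)))
           (⟦⟧-no (i ℕ.≟ toℕ (fromℕ (suc n))) (λ e → ℕ.<⇒≢ (ℕ.s<s⁻¹ i<q) (trans e (toℕ-fromℕ (suc n)))))) ⟩
    ⟦ does (i ℕ.≟ 0) ⟧ + + 0
      ≡⟨ ℤ.+-identityʳ _ ⟩
    ⟦ does (i ℕ.≟ 0) ⟧
      ≡⟨ ⟦⟧-cong (i ℕ.≟ 0) (suc i ℕ.≟ 1) (cong suc) ℕ.suc-injective ⟩
    ⟦ does (suc i ℕ.≟ 1) ⟧ ∎
    where open ≡-Reasoning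
  shifts-one (suc i) i<q (suc (suc k)) = trans (shifts-one i (ℕ.<⇒≤ i<q) (suc (inject₁ k)))
    (⟦⟧-cong (i ℕ.≟ suc (toℕ (inject₁ k))) (suc i ℕ.≟ suc (suc (toℕ k)))
      (λ e → cong suc (trans e (cong suc (toℕ-inject₁ k))))
      (λ e → trans (ℕ.suc-injective e) (cong suc (sym (toℕ-inject₁ k)))))

  shifts-basis : ∀ i → shifts (toℕ i) one ≗ₑ δ i
  shifts-basis i k = trans (shifts-one (toℕ i) (toℕ<n i) k) (⟦⟧-cong (toℕ i ℕ.≟ toℕ k) (i ≟ k) toℕ-injective (cong toℕ))

  -- The defining relation Y^q = Y: `shift` carries the 1 at the last index of Y^(q-1) to index 1.
  shifts-q : shifts q one ≗ₑ shift one
  shifts-q k = trans (shift-cong top k) (shift-δ-last k)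
    where
    open ≡-Reasoning
    last : Fin q
    last = fromℕ (suc n)
    top : shifts (suc n) one ≗ₑ δ last
    top k = subst (λ i → shifts i one k ≡ δ last k) (toℕ-fromℕ (suc n)) (shifts-basis last k)
    shift-δ-last : shift (δ last) ≗ₑ shift one
    shift-δ-last zero          = refl
    shift-δ-last (suc zero)    = cong₂ _+_ (δ-≢ {i = last} {zero} λ ()) (δ-refl last)
    shift-δ-last (suc (suc k)) = δ-≢ {i = last} {suc (inject₁ k)} λ e →
      ℕ.<⇒≢ (s≤s (toℕ<n k)) (sym (trans (sym (toℕ-fromℕ (suc n))) (trans (cong toℕ e) (cong suc (toℕ-inject₁ k)))))

  ∙-one : ∀ u → u ∙ one ≗ₑ u
  ∙-one u k = trans (∑-cong (λ i → cong (u i *_) (shifts-basis i k))) (∑*δ k u)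

  ∙-cong : ∀ {u u′ v v′} → u ≗ₑ u′ → v ≗ₑ v′ → u ∙ v ≗ₑ u′ ∙ v′
  ∙-cong u≗u′ v≗v′ k = ∑-cong (λ i → cong₂ _*_ (u≗u′ i) (shifts-cong (toℕ i) v≗v′ k))

  -- Both sides are the double sum of u_i v_j Y^(i+j) w, which is symmetric in u and v. Together
  -- with the right unit `one` this yields commutativity and then associativity.
  ∙-swap : ∀ u v w → u ∙ (v ∙ w) ≗ₑ v ∙ (u ∙ w)
  ∙-swap u v w k = begin
    ∑[ i < q ] (u i * shifts (toℕ i) (v ∙ w) k)
      ≡⟨ ∑-cong (λ i → expand u v i) ⟩
    ∑[ i < q ] ∑[ j < q ] (u i * (v j * shifts (toℕ i ℕ.+ toℕ j) w k))
      ≡⟨ ∑-comm (λ i j → u i * (v j * shifts (toℕ i ℕ.+ toℕ j) w k)) ⟩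
    ∑[ j < q ] ∑[ i < q ] (u i * (v j * shifts (toℕ i ℕ.+ toℕ j) w k))
      ≡⟨ ∑-cong (λ j → ∑-cong (λ i → trans (x∙yz≈y∙xz (u i) (v j) _)
           (cong (λ e → v j * (u i * shifts e w k)) (ℕ.+-comm (toℕ i) (toℕ j))))) ⟩
    ∑[ j < q ] ∑[ i < q ] (v j * (u i * shifts (toℕ j ℕ.+ toℕ i) w k))
      ≡⟨ ∑-cong (λ j → expand v u j) ⟨
    ∑[ j < q ] (v j * shifts (toℕ j) (u ∙ w) k) ∎
    where
    open ≡-Reasoning
    open import Algebra.Properties.CommutativeSemigroup ℤ.*-commutativeSemigroup using (x∙yz≈y∙xz)
    expand : ∀ u v i → u i * shifts (toℕ i) (v ∙ w) k ≡ ∑[ j < q ] (u i * (v j * shifts (toℕ i ℕ.+ toℕ j) w k))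
    expand u v i = begin
      u i * shifts (toℕ i) (v ∙ w) k
        ≡⟨ cong (u i *_) (shifts-linear (toℕ i) v (λ j → shifts (toℕ j) w) k) ⟩
      u i * ∑[ j < q ] (v j * shifts (toℕ i) (shifts (toℕ j) w) k)
        ≡⟨ cong (u i *_) (∑-cong (λ j → cong (λ s → v j * s k) (shifts-+ (toℕ i) (toℕ j) w))) ⟩
      u i * ∑[ j < q ] (v j * shifts (toℕ i ℕ.+ toℕ j) w k)
        ≡⟨ *-∑ (u i) (λ j → v j * shifts (toℕ i ℕ.+ toℕ j) w k) ⟨
      ∑[ j < q ] (u i * (v j * shifts (toℕ i ℕ.+ toℕ j) w k)) ∎

  ∙-comm : ∀ u v → u ∙ v ≗ₑ v ∙ u
  ∙-comm u v k = begin
    (u ∙ v) k           ≡⟨ ∙-cong {u} (λ _ → refl) (∙-one v) k ⟨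
    (u ∙ (v ∙ one)) k   ≡⟨ ∙-swap u v one k ⟩
    (v ∙ (u ∙ one)) k   ≡⟨ ∙-cong {v} (λ _ → refl) (∙-one u) k ⟩
    (v ∙ u) k           ∎
    where open ≡-Reasoning

  ∙-assoc : ∀ u v w → u ∙ v ∙ w ≗ₑ u ∙ (v ∙ w)
  ∙-assoc u v w k = begin
    (u ∙ v ∙ w) k     ≡⟨ ∙-comm (u ∙ v) w k ⟩
    (w ∙ (u ∙ v)) k   ≡⟨ ∙-swap w u v k ⟩
    (u ∙ (w ∙ v)) k   ≡⟨ ∙-cong {u} (λ _ → refl) (∙-comm w v) k ⟩
    (u ∙ (v ∙ w)) k   ∎
    where open ≡-Reasoning

  _⊕_ : Element → Element → Element
  (u ⊕ v) k = u k + v k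

  ∙-distribʳ : ∀ w u v → (u ⊕ v) ∙ w ≗ₑ (u ∙ w) ⊕ (v ∙ w)
  ∙-distribʳ w u v k = trans
    (∑-cong (λ i → ℤ.*-distribʳ-+ (shifts (toℕ i) w k) (u i) (v i)))
    (∑-distrib-+ (λ i → u i * shifts (toℕ i) w k) (λ i → v i * shifts (toℕ i) w k))

  ∙-distribˡ : ∀ w u v → w ∙ (u ⊕ v) ≗ₑ (w ∙ u) ⊕ (w ∙ v)
  ∙-distribˡ w u v k = trans (∙-comm w (u ⊕ v) k)
    (trans (∙-distribʳ w u v k) (cong₂ _+_ (∙-comm u w k) (∙-comm v w k)))

  ring : CommutativeRing 0ℓ 0ℓ
  ring = record
    { Carrier = Element ; _≈_ = _≗ₑ_ ; _+_ = _⊕_ ; _*_ = _∙_ ; -_ = λ u k → - u k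
    ; 0# = λ _ → + 0 ; 1# = one
    ; isCommutativeRing = record
      { isRing = record
        { +-isAbelianGroup = Pointwise.isAbelianGroup (Fin q) ℤ.+-0-isAbelianGroup
        ; *-cong = ∙-cong
        ; *-assoc = ∙-assoc
        ; *-identity = (λ u k → trans (∙-comm one u k) (∙-one u k)) , ∙-one
        ; distrib = ∙-distribˡ , ∙-distribʳ
        }
      ; *-comm = ∙-comm
      }
    }

  Y : Element
  Y = shift one

  Y∙ : ∀ v → Y ∙ v ≗ₑ shift v
  Y∙ v k = begin
    (Y ∙ v) k                                             ≡⟨ ∙-comm Y v k ⟩
    ∑[ i < q ] (v i * shifts (toℕ i) (shift one) k)       ≡⟨ ∑-cong (λ i → cong (λ s → v i * s k) (commute (toℕ i))) ⟩
    ∑[ i < q ] (v i * shift (shifts (toℕ i) one) k)       ≡⟨ shift-linear v (λ i → shifts (toℕ i) one) k ⟨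
    shift (v ∙ one) k                                     ≡⟨ shift-cong (∙-one v) k ⟩
    shift v k                                             ∎
    where
    open ≡-Reasoning
    commute : ∀ i → shifts i (shift one) ≡ shift (shifts i one)
    commute zero    = refl
    commute (suc i) = cong shift (commute i)

  open Exp (CommutativeRing.semiring ring) using (_^_)

  Y^ : ∀ m v → (Y ^ m) ∙ v ≗ₑ shifts m v
  Y^ zero    v k = trans (∙-comm one v k) (∙-one v k)
  Y^ (suc m) v k = trans (∙-assoc Y (Y ^ m) v k) (trans (Y∙ ((Y ^ m) ∙ v) k) (shift-cong (Y^ m v) k))

  Y^q≗Y : Y ^ q ≗ₑ Y
  Y^q≗Y k = trans (sym (∙-one (Y ^ q) k)) (trans (Y^ q one k) (shifts-q k))

  -- The leading index is given by its number, which spares casts from D to `Fin q`; the record is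
  -- applied with D < q, where that index exists.
  record Monic (D : ℕ) (v : Element) : Set where
    field
      leading : ∀ k → toℕ k ≡ D → v k ≡ + 1
      above   : ∀ k → D ℕ.< toℕ k → v k ≡ + 0

  open Monic

  -- As D + 1 < q, the top coefficient of `v` is 0 and wraps nothing into the coefficient of Y. This
  -- matters for D = 0, where that coefficient becomes the leading one.
  shift-monic : ∀ {D v} → suc D ℕ.< q → Monic D v → Monic (suc D) (shift v)
  shift-monic {D} {v} D<q m .leading (suc zero) e = cong₂ _+_
    (leading m zero (ℕ.suc-injective e))
    (above m (fromℕ (suc n)) (subst (ℕ._< suc (toℕ (fromℕ n))) (ℕ.suc-injective e) (s≤s z≤n)))
  shift-monic m<q m .leading (suc (suc k)) e = leading m (suc (inject₁ k)) (trans (cong suc (toℕ-inject₁ k)) (ℕ.suc-injective e))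
  shift-monic m<q m .above (suc zero) (s≤s ())
  shift-monic {D} m<q m .above (suc (suc k)) (s≤s D<) = above m (suc (inject₁ k)) (subst (λ i → D ℕ.< suc i) (sym (toℕ-inject₁ k)) D<)

  shifts-monic : ∀ i {D v} → i ℕ.+ D ℕ.< q → Monic D v → Monic (i ℕ.+ D) (shifts i v)
  shifts-monic zero    _   m = m
  shifts-monic (suc i) <q m = shift-monic <q (shifts-monic i (ℕ.<⇒≤ <q) m)

  one-monic : Monic 0 one
  one-monic .leading zero    _ = refl
  one-monic .above   (suc k) _ = refl

  open CommutativeRing ring using () renaming (_-_ to _⊖_)

  -- The product is Y^i v - Y v, and 1 < i keeps the second term below the leading coefficient of
  -- the first.
  difference-monic : ∀ {i D v} → 1 ℕ.< i → i ℕ.+ D ℕ.< q → Monic D v → Monic (i ℕ.+ D) ((Y ^ i ⊖ Y) ∙ v)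
  difference-monic {i} {D} {v} 1<i <q m = record
    { leading = λ k e → begin
        ((Y ^ i ⊖ Y) ∙ v) k                  ≡⟨ expand k ⟩
        shifts i v k - shift v k             ≡⟨ cong₂ _-_ (leading mᵢ k e) (above m₁ k (subst (suc D ℕ.<_) (sym e) (ℕ.+-monoˡ-< D 1<i))) ⟩
        + 1                                  ∎
    ; above = λ k lt → begin
        ((Y ^ i ⊖ Y) ∙ v) k                  ≡⟨ expand k ⟩
        shifts i v k - shift v k             ≡⟨ cong₂ _-_ (above mᵢ k lt) (above m₁ k (ℕ.<-trans (ℕ.+-monoˡ-< D 1<i) lt)) ⟩
        + 0                                  ∎
    }
    where
    open ≡-Reasoning
    open import Algebra.Properties.Ring (CommutativeRing.ring ring) using ([y-z]x≈yx-zx)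
    mᵢ : Monic (i ℕ.+ D) (shifts i v)
    mᵢ = shifts-monic i <q m
    m₁ : Monic (suc D) (shift v)
    m₁ = shift-monic (ℕ.<-trans (ℕ.+-monoˡ-< D 1<i) <q) m
    expand : ∀ k → ((Y ^ i ⊖ Y) ∙ v) k ≡ shifts i v k - shift v k
    expand k = trans ([y-z]x≈yx-zx v (Y ^ i) Y k) (cong₂ _-_ (Y^ i v k) (Y∙ v k))

-- Construction of the field with p^d elements

record FiniteDomain (m : ℕ) : Set₁ where
  field
    ring : CommutativeRing 0ℓ 0ℓ
  open CommutativeRing ring public hiding (zero; ring)
  field
    integral           : ∀ {a b} → a * b ≈ 0# → a ≈ 0# ⊎ b ≈ 0#
    element            : Fin m → Carrier
    element-injective  : ∀ {i j} → element i ≈ element j → i ≡ j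
    element-surjective : ∀ t → ∃ λ i → element i ≈ t

-- degree e is the degree of the product of the polynomials Y^(p^i) − Y, 1 ≤ i ≤ e.
module Degrees {p : ℕ} (1<p : 1 ℕ.< p) where

  private
    instance
      p≢0 : ℕ.NonZero p
      p≢0 = ℕ.>-nonZero (ℕ.<⇒≤ 1<p)

  1<p^ : ∀ e → 1 ℕ.< p ℕ.^ suc e
  1<p^ e = ℕ.<-≤-trans 1<p (ℕ.≤-trans (ℕ.≤-reflexive (≡.sym (ℕ.*-identityʳ p))) (ℕ.*-monoʳ-≤ p (ℕ.m^n>0 p e)))

  degree : ℕ → ℕ
  degree zero    = 0
  degree (suc e) = p ℕ.^ suc e ℕ.+ degree e

  -- Inductively p^(e+1) + `degree e` is less than 2 p^(e+1), which is at most p^(e+2).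
  degree<p^ : ∀ e → degree e ℕ.< p ℕ.^ suc e
  degree<p^ zero    = ℕ.m^n>0 p 1
  degree<p^ (suc e) = begin-strict
    p ℕ.^ suc e ℕ.+ degree e           <⟨ ℕ.+-monoʳ-< (p ℕ.^ suc e) (degree<p^ e) ⟩
    p ℕ.^ suc e ℕ.+ p ℕ.^ suc e        ≡⟨ ≡.cong (p ℕ.^ suc e ℕ.+_) (ℕ.+-identityʳ (p ℕ.^ suc e)) ⟨
    2 ℕ.* p ℕ.^ suc e                  ≤⟨ ℕ.*-monoˡ-≤ (p ℕ.^ suc e) 1<p ⟩
    p ℕ.* p ℕ.^ suc e                  ∎
    where open ℕ.≤-Reasoning

-- `CyclicRing` takes its number of coefficients in the form n + 2, so p^d enters through the
-- equation `q≡p^d`.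
module Construction {p : ℕ} (pr : Prime p) (d′ n : ℕ) (q≡p^d : suc (suc n) ≡ p ℕ.^ suc d′) where

  private
    d = suc d′

    instance
      p≢0 : ℕ.NonZero p
      p≢0 = prime⇒nonZero pr

    open CyclicRing n
    open IntegerSums using (sum-syntax)

    1<p : 1 ℕ.< p
    1<p = ℕ.nonTrivial⇒n>1 p {{prime⇒nonTrivial pr}}

    module R₀ = CommutativeRing ring
    module I₀ = Ideals ring
    open Exp R₀.semiring using () renaming (_^_ to _^₀_)
    open Mult R₀.+-monoid using () renaming (_×_ to _×₀_)

    ∣-∑ : ∀ {m} (f : Fin m → ℤ) → (∀ i → + p ℤ.∣ f i) → + p ℤ.∣ ∑[ i < m ] f i
    ∣-∑ {zero}  f _  = divides (+ 0) ≡.refl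
    ∣-∑ {suc m} f p∣ = ∣m∣n⇒∣m+n (p∣ zero) (∣-∑ (f ∘ suc) (p∣ ∘ suc))

    -- Reduction modulo p, coefficient by coefficient; the quotient `R` is 𝔽_p[Y]/(Y^q - Y).
    ⟨p⟩ : I₀.Ideal
    ⟨p⟩ = record
      { Member   = λ u → ∀ k → + p ℤ.∣ u k
      ; respects = λ u≗v p∣u k → ≡.subst (+ p ℤ.∣_) (u≗v k) (p∣u k)
      ; 0∈       = λ _ → divides (+ 0) ≡.refl
      ; +-closed = λ p∣u p∣v k → ∣m∣n⇒∣m+n (p∣u k) (p∣v k)
      ; absorbs  = λ r {u} p∣u k → ≡.subst (+ p ℤ.∣_) (∙-comm u r k)
          (∣-∑ (λ i → u i ℤ.* shifts (toℕ i) r k) (λ i → ∣m⇒∣m*n (shifts (toℕ i) r k) (p∣u i)))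
      }

    R : CommutativeRing 0ℓ 0ℓ
    R = I₀.quotient ⟨p⟩

    open CommutativeRing R hiding (zero; ring)
    open Ideals R
    open import Algebra.Properties.Ring (CommutativeRing.ring R) using (x[y-z]≈xy-xz; x≈y⇒x∙y⁻¹≈ε; -0#≈0#)
    open Exp semiring
    open import Algebra.Properties.CommutativeSemiring.Exp commutativeSemiring using (^-distrib-*)
    open Mult +-monoid using (_×_)
    open import Relation.Binary.Reasoning.Setoid setoid

    _≈?_ : ∀ u v → Dec (u ≈ v)
    u ≈? v = all? (λ k → + p ℤ.∣? (u k ℤ.- v k))

    lift : ∀ {u v} → u ≗ₑ v → u ≈ v
    lift {u} {v} = I₀.quotient-≈ ⟨p⟩ {u} {v}

    lift^ : ∀ u m {v} → u ^₀ m ≗ₑ v → u ^ m ≈ v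
    lift^ u m {v} e = ≡.subst (_≈ v) (≡.sym (I₀.quotient-^ ⟨p⟩ u m)) (lift e)

    -- The p^q vectors with entries from 0 to p - 1 represent all of `R`, which makes the search for
    -- a maximal ideal finite.
    residues : Fin (p ℕ.^ q) → Element
    residues i k = + toℕ (finToFun {p} {q} i k)

    residues-surjective : ∀ u → ∃ λ i → u ≈ residues i
    residues-surjective u = funToFin residue , λ k →
      ≡.subst (λ r → + p ℤ.∣ (u k ℤ.- + toℕ r)) (≡.sym (finToFun-funToFin residue k))
        (≡.subst (λ r → + p ℤ.∣ (u k ℤ.- + r)) (≡.sym (toℕ-fromℕ< (n%ℕd<d (u k) p)))
          (divides (u k /ℕ p) (≡.trans (≡.cong (ℤ._- + (u k %ℕ p)) (a≡a%ℕn+[a/ℕn]*n (u k) p))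
            (cancel (+ (u k %ℕ p)) ((u k /ℕ p) ℤ.* + p)))))
      where
      residue : Fin q → Fin p
      residue k = fromℕ< (n%ℕd<d (u k) p)
      cancel : ∀ r s → r ℤ.+ s ℤ.- r ≡ s
      cancel = solve-∀

    ×₀-pointwise : ∀ m u k → (m ×₀ u) k ≡ + m ℤ.* u k
    ×₀-pointwise zero    u k = ≡.sym (ℤ.*-zeroˡ (u k))
    ×₀-pointwise (suc m) u k = ≡.trans (≡.cong (ℤ._+_ (u k)) (×₀-pointwise m u k)) (≡.sym (ℤ.suc-* (+ m) (u k)))

    p×1≈0 : p × 1# ≈ 0#
    p×1≈0 = ≡.subst (_≈ 0#) (≡.sym (I₀.quotient-× ⟨p⟩ p one)) (λ k →
      divides (one k) (≡.trans (≡.cong (ℤ._- + 0) (×₀-pointwise p one k)) (lemma (+ p) (one k))))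
      where
      lemma : ∀ p u → p ℤ.* u ℤ.- + 0 ≡ u ℤ.* p
      lemma = solve-∀

    open Characteristic R pr p×1≈0

    Q : ℕ
    Q = p ℕ.^ d

    Fixed : Element → Set
    Fixed t = t ^ Q ≈ t

    Fixed-≈ : ∀ {u v} → u ≈ v → Fixed u → Fixed v
    Fixed-≈ {u} {v} u≈v fix = begin
      v ^ Q  ≈⟨ ^-congˡ Q {u} {v} u≈v ⟨
      u ^ Q  ≈⟨ fix ⟩
      u      ≈⟨ u≈v ⟩
      v      ∎

    Fixed-+ : ∀ {u v} → Fixed u → Fixed v → Fixed (u + v)
    Fixed-+ {u} {v} fu fv = begin
      (u + v) ^ Q    ≈⟨ ^pᵉ-homo-+ d u v ⟩
      u ^ Q + v ^ Q  ≈⟨ +-cong {u ^ Q} {u} {v ^ Q} {v} fu fv ⟩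
      u + v          ∎

    Fixed-neg : ∀ {u} → Fixed u → Fixed (- u)
    Fixed-neg {u} fu = begin
      (- u) ^ Q  ≈⟨ ^pᵉ-homo-neg d u ⟩
      - (u ^ Q)  ≈⟨ -‿cong {u ^ Q} {u} fu ⟩
      - u        ∎

    Fixed-0 : Fixed 0#
    Fixed-0 = 0^pᵉ≈0 d

    Fixed-shift : ∀ {u} → Fixed u → Fixed (shift u)
    Fixed-shift {u} fu = Fixed-≈ {Y * u} {shift u} (lift (Y∙ u)) (begin
      (Y * u) ^ Q    ≈⟨ ^-distrib-* Y u Q ⟩
      Y ^ Q * u ^ Q  ≈⟨ *-cong {Y ^ Q} {Y} {u ^ Q} {u} (≡.subst (λ m → Y ^ m ≈ Y) q≡p^d (lift^ Y q Y^q≗Y)) fu ⟩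
      Y * u          ∎)

    Fixed-scale⁺ : ∀ m {u} → Fixed u → Fixed (λ k → + m ℤ.* u k)
    Fixed-scale⁺ zero {u} fu = Fixed-≈ {0#} {λ k → + 0 ℤ.* u k} (lift (λ k → ≡.sym (ℤ.*-zeroˡ (u k)))) Fixed-0
    Fixed-scale⁺ (suc m) {u} fu = Fixed-≈ {u + (λ k → + m ℤ.* u k)} {λ k → + suc m ℤ.* u k}
      (lift (λ k → ≡.sym (ℤ.suc-* (+ m) (u k)))) (Fixed-+ {u} {λ k → + m ℤ.* u k} fu (Fixed-scale⁺ m fu))

    Fixed-scale : ∀ c {u} → Fixed u → Fixed (λ k → c ℤ.* u k)
    Fixed-scale (+ m)    fu = Fixed-scale⁺ m fu
    Fixed-scale -[1+ m ] {u} fu = Fixed-≈ {λ k → ℤ.- (+ suc m ℤ.* u k)} {λ k → -[1+ m ] ℤ.* u k}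
      (lift (λ k → ℤ.neg-distribˡ-* (+ suc m) (u k))) (Fixed-neg {λ k → + suc m ℤ.* u k} (Fixed-scale⁺ (suc m) fu))

    Fixed-∑ : ∀ {m} (c : Fin m → ℤ) (v : Fin m → Element) → (∀ i → Fixed (v i)) → Fixed (λ k → ∑[ i < m ] (c i ℤ.* v i k))
    Fixed-∑ {zero}  c v fv = Fixed-0
    Fixed-∑ {suc m} c v fv = Fixed-+ {λ k → c zero ℤ.* v zero k} {λ k → ∑[ i < m ] (c (suc i) ℤ.* v (suc i) k)}
      (Fixed-scale (c zero) (fv zero)) (Fixed-∑ (c ∘ suc) (v ∘ suc) (fv ∘ suc))

    Fixed-shifts : ∀ i → Fixed (shifts i one)
    Fixed-shifts zero    = 1^n≈1 Q
    Fixed-shifts (suc i) = Fixed-shift (Fixed-shifts i)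

    -- In characteristic p the map t ↦ t^Q is additive and multiplicative, and it fixes Y because
    -- Y^q = Y. Hence it fixes all integer combinations of powers of Y, that is, every element of
    -- `R`.
    fermat : ∀ t → Fixed t
    fermat t = Fixed-≈ {t ∙ one} {t} (lift (∙-one t)) (Fixed-∑ t (λ i → shifts (toℕ i) one) (λ i → Fixed-shifts (toℕ i)))

    -- The factors are formed with integer coefficients, where `difference-monic` reads off degree
    -- and leading coefficient before reduction modulo p.
    Φ : ℕ → Element
    Φ zero    = one
    Φ (suc e) = (Y ^₀ (p ℕ.^ suc e) R₀.- Y) * Φ e

    open Degrees 1<p

    degree<q : ∀ {e} → e ℕ.< d → degree e ℕ.< q
    degree<q {e} e<d = ℕ.<-≤-trans (degree<p^ e) (ℕ.≤-trans (ℕ.^-monoʳ-≤ p e<d) (ℕ.≤-reflexive (≡.sym q≡p^d)))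

    Φ-monic : ∀ e → e ℕ.< d → Monic (degree e) (Φ e)
    Φ-monic zero    _   = one-monic
    Φ-monic (suc e) e<d = difference-monic (1<p^ e) (degree<q e<d) (Φ-monic e (ℕ.<⇒≤ e<d))

    b : Element
    b = Φ d′

    Ann-b : Proper
    Ann-b = record
      { ideal   = annihilator b
      ; member? = λ u → (b * u) ≈? 0#
      -- If b were zero in `R`, p would divide its leading coefficient, which is 1.
      ; 1∉      = λ b*1≈0 → ℕ.>⇒∤ 1<p (∣⇒∣ᵤ (≡.subst (+ p ℤ.∣_) coefficient (b*1≈0 top)))
      }
      where
      top : Fin q
      top = fromℕ< (degree<q {d′} ℕ.≤-refl)
      coefficient : (b * 1#) top ℤ.- + 0 ≡ + 1
      coefficient = ≡.trans (ℤ.+-identityʳ _) (≡.trans (∙-one b top)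
        (Monic.leading (Φ-monic d′ ℕ.≤-refl) top (toℕ-fromℕ< (degree<q {d′} ℕ.≤-refl))))

    maximal : _
    maximal = maximalIdeal residues residues-surjective Ann-b

    J : Proper
    J = proj₁ maximal

    module J = Proper J

    K : CommutativeRing 0ℓ 0ℓ
    K = quotient J.ideal

    module K = CommutativeRing K

    K-lift : ∀ {u v} → u ≈ v → u K.≈ v
    K-lift {u} {v} = quotient-≈ J.ideal {u} {v}

    ∈J⇒≈0 : ∀ {u} → J.Member u → u K.≈ 0#
    ∈J⇒≈0 {u} = J.respects {u} {u - 0#} (begin
      u        ≈⟨ +-identityʳ u ⟨
      u + 0#   ≈⟨ +-congˡ {u} {0#} { - 0# } (sym { - 0# } {0#} -0#≈0#) ⟩
      u - 0#   ∎)

    ≈0⇒∈J : ∀ {u} → u K.≈ 0# → J.Member u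
    ≈0⇒∈J {u} = J.respects {u - 0#} {u} (begin
      u - 0#   ≈⟨ +-congˡ {u} { - 0# } {0#} -0#≈0# ⟩
      u + 0#   ≈⟨ +-identityʳ u ⟩
      u        ∎)

    K-invertible : ∀ u → u K.≈ 0# ⊎ ∃ λ r → 1# K.≈ r * u
    K-invertible u with proj₂ (proj₂ maximal) u
    ... | inj₁ m       = inj₁ (∈J⇒≈0 {u} m)
    ... | inj₂ (r , m) = inj₂ (r , m)

    -- b (1 - b^(q-1)) = b - b^q = 0, so J contains 1 - b^(q-1).
    b∉J : ¬ J.Member b
    b∉J b∈J = J.1∉ (J.respects {(1# - c) + c} {1#} add-back (J.+-closed {1# - c} {c} (proj₁ (proj₂ maximal) {1# - c} killed) c∈J))
      where
      c : Element
      c = b ^ suc n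
      c∈J : J.Member c
      c∈J = J.respects {b ^ n * b} {c} (*-comm (b ^ n) b) (J.absorbs (b ^ n) {b} b∈J)
      killed : b * (1# - c) ≈ 0#
      killed = begin
        b * (1# - c)     ≈⟨ x[y-z]≈xy-xz b 1# c ⟩
        b * 1# - b * c   ≈⟨ x≈y⇒x∙y⁻¹≈ε {b * 1#} {b * c} (begin
          b * 1#           ≈⟨ *-identityʳ b ⟩
          b                ≈⟨ fermat b ⟨
          b ^ Q            ≡⟨ ≡.cong (b ^_) q≡p^d ⟨
          b * c            ∎) ⟩
        0#               ∎
      add-back : (1# - c) + c ≈ 1#
      add-back = begin
        (1# - c) + c     ≈⟨ +-assoc 1# (- c) c ⟩
        1# + (- c + c)   ≈⟨ +-congˡ {1#} { - c + c} {0#} (-‿inverseˡ c) ⟩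
        1# + 0#          ≈⟨ +-identityʳ 1# ⟩
        1#               ∎

    -- For 1 ≤ e ≤ m the element Y^(p^e) - Y is one of the factors of `Φ m`.
    Φ∈J : ∀ {e} m → 1 ℕ.≤ e → e ℕ.≤ m → J.Member (Y ^₀ (p ℕ.^ e) R₀.- Y) → J.Member (Φ m)
    Φ∈J zero (s≤s _) () _
    Φ∈J {e} (suc m) 1≤e e≤m e∈J with ℕ.m≤n⇒m<n∨m≡n e≤m
    ... | inj₁ (s≤s e≤m) = J.absorbs (Y ^₀ (p ℕ.^ suc m) R₀.- Y) {Φ m} (Φ∈J m 1≤e e≤m e∈J)
    ... | inj₂ ≡.refl = J.respects {Φ m * u} {u * Φ m} (*-comm (Φ m) u) (J.absorbs (Φ m) {u} e∈J)
      where
      u : Element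
      u = Y ^₀ (p ℕ.^ e) R₀.- Y

    -- If Y^(p^e) = Y held in `K`, a factor of b would lie in J, and with it b, against `b∉J`.
    K-generic : ∀ {e} → 1 ℕ.≤ e → e ℕ.< d → ¬ Exp._^_ K.semiring Y (p ℕ.^ e) K.≈ Y
    K-generic {e} 1≤e (s≤s e≤d′) eq = b∉J (Φ∈J d′ 1≤e e≤d′ (≡.subst (λ u → J.Member (u - Y))
      (≡.trans (quotient-^ J.ideal Y (p ℕ.^ e)) (I₀.quotient-^ ⟨p⟩ Y (p ℕ.^ e))) eq))

    K-field : FrobeniusField K p d
    K-field = record
      { _≈?_       = λ u v → J.member? (u - v)
      ; 1≉0        = J.1∉ ∘ ≈0⇒∈J {1#}
      ; invertible = K-invertible
      ; p×1≈0      = ≡.subst (K._≈ 0#) (≡.sym (quotient-× J.ideal p 1#)) (K-lift {p × 1#} {0#} p×1≈0)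
      ; fermat     = λ t → ≡.subst (K._≈ t) (≡.sym (quotient-^ J.ideal t Q)) (K-lift {t ^ Q} {t} (fermat t))
      ; x          = Y
      ; generic    = K-generic
      }

    module F = FiniteField pr (s≤s z≤n) K-field

  domain : FiniteDomain (p ℕ.^ d)
  domain = record
    { ring               = K
    ; integral           = λ {a} {b} → F.integral {a} {b}
    ; element            = F.element
    ; element-injective  = F.element-injective
    ; element-surjective = F.element-surjective
    }

finiteDomain : ∀ {p} → Prime p → ∀ {d} → 1 ℕ.≤ d → FiniteDomain (p ℕ.^ d)
finiteDomain {p} pr {suc d′} _ = go (p ℕ.^ suc d′) ≡.refl (Degrees.1<p^ (ℕ.nonTrivial⇒n>1 p {{prime⇒nonTrivial pr}}) d′)
  where
  go : ∀ q → q ≡ p ℕ.^ suc d′ → 2 ℕ.≤ q → FiniteDomain (p ℕ.^ suc d′)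
  go (suc (suc n)) q≡ _ = Construction.domain pr d′ n q≡
  go (suc zero) _ (s≤s ())

-- The affine plane over the field and its powers

open import Data.Integer.Base using (_+_; _-_; _*_; _^_; _≤_)
open import Data.Product.Base using (_×_)
open import Relation.Binary.PropositionalEquality
open IntegerSums
open Nets

module AffinePlane {m : ℕ} (D : FiniteDomain m) where

  private
    module D = FiniteDomain D
    open D using (_≈_; element)
    open import Algebra.Properties.Ring (CommutativeRing.ring D.ring)
    open import Relation.Binary.Reasoning.Setoid D.setoid

    index : D.Carrier → Fin m
    index t = proj₁ (D.element-surjective t)

    index-injective : ∀ {s t} → index s ≡ index t → s ≈ t
    index-injective {s} {t} e = begin
      s                   ≈⟨ proj₂ (D.element-surjective s) ⟨
      element (index s)   ≡⟨ cong element e ⟩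
      element (index t)   ≈⟨ proj₂ (D.element-surjective t) ⟩
      t                   ∎

    xᵢ yᵢ : Fin (m ℕ.* m) → Fin m
    xᵢ X = proj₁ (remQuot {m} m X)
    yᵢ X = proj₂ (remQuot {m} m X)

    x y : Fin (m ℕ.* m) → D.Carrier
    x = element ∘ xᵢ
    y = element ∘ yᵢ

    -- Class zero consists of the lines with constant x, class suc a of those of slope −a.
    line : Fin (suc m) → Fin (m ℕ.* m) → Fin m
    line zero    X = xᵢ X
    line (suc a) X = index (y X D.+ element a D.* x X)

    same-x : ∀ {a X Y} → xᵢ X ≡ xᵢ Y → line (suc a) X ≡ line (suc a) Y → X ≡ Y
    same-x {a} {X} {Y} ex e = remQuot-injective {m} ex (D.element-injective (+-cancelʳ (element a D.* x X) (y X) (y Y) (begin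
      y X D.+ element a D.* x X   ≈⟨ index-injective e ⟩
      y Y D.+ element a D.* x Y   ≡⟨ cong (λ t → y Y D.+ element a D.* element t) ex ⟨
      y Y D.+ element a D.* x X   ∎)))

    -- Rearranges the equality of the labels y + a x of two points, so that two slopes can be
    -- compared by subtraction.
    slope : ∀ {a X Y} → line (suc a) X ≡ line (suc a) Y → element a D.* (x Y D.- x X) ≈ y X D.- y Y
    slope {a} {X} {Y} e = begin
      element a D.* (x Y D.- x X)                ≈⟨ x[y-z]≈xy-xz (element a) (x Y) (x X) ⟩
      aY D.- aX                                  ≈⟨ ⁻¹-anti-homo‿- aX aY ⟨
      D.- (aX D.- aY)                            ≈⟨ +-inverseˡ-unique (y X D.- y Y) (aX D.- aY) (begin
        (y X D.- y Y) D.+ (aX D.- aY)              ≈⟨ interchange (y X) (D.- y Y) aX (D.- aY) ⟩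
        (y X D.+ aX) D.+ (D.- y Y D.- aY)          ≈⟨ D.+-congˡ (-‿+-comm (y Y) aY) ⟩
        (y X D.+ aX) D.- (y Y D.+ aY)              ≈⟨ x≈y⇒x∙y⁻¹≈ε (index-injective e) ⟩
        D.0#                                       ∎) ⟨
      y X D.- y Y                                ∎
      where
      open import Algebra.Properties.CommutativeSemigroup D.+-commutativeSemigroup using (interchange)
      aX = element a D.* x X
      aY = element a D.* x Y

    -- Subtracting the `slope` equations for a and b gives (a - b)(x Y - x X) = 0. Integrality
    -- leaves x X = x Y, and then either label determines y.
    separate : ∀ {i j X Y} → i ≢ j → line i X ≡ line i Y → line j X ≡ line j Y → X ≡ Y
    separate {zero}  {zero}  0≢0 _  _  = contradiction refl 0≢0
    separate {zero}  {suc b} _   e₀ eᵦ = same-x e₀ eᵦ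
    separate {suc a} {zero}  _   eₐ e₀ = same-x e₀ eₐ
    separate {suc a} {suc b} {X} {Y} a≢b eₐ eᵦ with D.integral {element a D.- element b} {x Y D.- x X} (begin
        (element a D.- element b) D.* (x Y D.- x X)
          ≈⟨ [y-z]x≈yx-zx (x Y D.- x X) (element a) (element b) ⟩
        element a D.* (x Y D.- x X) D.- element b D.* (x Y D.- x X)
          ≈⟨ x≈y⇒x∙y⁻¹≈ε (D.trans (slope eₐ) (D.sym (slope eᵦ))) ⟩
        D.0# ∎)
    ... | inj₁ a-b≈0 = contradiction (cong suc (D.element-injective (x∙y⁻¹≈ε⇒x≈y _ _ a-b≈0))) a≢b
    ... | inj₂ Δx≈0  = same-x (sym (D.element-injective (x∙y⁻¹≈ε⇒x≈y _ _ Δx≈0))) eₐ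

  affinePlane : Net (suc m) m
  affinePlane = record { line = line ; separate = separate }

module Power {n m : ℕ} (net : Net n m) (s : ℕ) where

  private
    open Net net

    M : ℕ
    M = m ℕ.^ s

    first second : Fin (M ℕ.* M) → Fin s → Fin m
    first  X = finToFun (proj₁ (remQuot {M} M X))
    second X = finToFun (proj₂ (remQuot {M} M X))

    -- A pair of numbers below m^s is split into s pairs of base-m digits, each of which is a point
    -- of the given net.
    digit : Fin (M ℕ.* M) → Fin s → Fin (m ℕ.* m)
    digit X r = combine (first X r) (second X r)

    lineˢ : Fin n → Fin (M ℕ.* M) → Fin M
    lineˢ i X = funToFin (λ r → line i (digit X r))

    digits-agree : ∀ {i X Y} → lineˢ i X ≡ lineˢ i Y → ∀ r → line i (digit X r) ≡ line i (digit Y r)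
    digits-agree {i} {X} {Y} e r = trans (sym (finToFun-funToFin (λ r → line i (digit X r)) r))
      (trans (cong (λ a → finToFun a r) e) (finToFun-funToFin (λ r → line i (digit Y r)) r))

    separateˢ : ∀ {i j X Y} → i ≢ j → lineˢ i X ≡ lineˢ i Y → lineˢ j X ≡ lineˢ j Y → X ≡ Y
    separateˢ {i} {j} {X} {Y} i≢j eᵢ eⱼ =
      remQuot-injective {M} (finToFun-injective (proj₁ ∘ digit≡)) (finToFun-injective (proj₂ ∘ digit≡))
      where
      digit≡ : ∀ r → first X r ≡ first Y r × second X r ≡ second Y r
      digit≡ r = combine-injective (first X r) (second X r) (first Y r) (second Y r)
        (separate i≢j (digits-agree {i} {X} {Y} eᵢ r) (digits-agree {j} {X} {Y} eⱼ r))

  power : Net n (m ℕ.^ s)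
  power = record { line = lineˢ ; separate = λ {i} {j} {X} {Y} → separateˢ {i} {j} {X} {Y} }

restrict : ∀ {n n′ q} → n′ ℕ.≤ n → Net n q → Net n′ q
restrict n′≤n net = record
  { line     = λ i → line (inject≤ i n′≤n)
  ; separate = λ i≢j → separate (i≢j ∘ inject≤-injective n′≤n n′≤n _ _)
  }
  where open Net net

-- Parameters and conclusion

pos-^ : ∀ m n → (+ m) ^ n ≡ + (m ℕ.^ n)
pos-^ m zero    = refl
pos-^ m (suc n) = trans (cong (+ m *_) (pos-^ m n)) (sym (ℤ.pos-* m (m ℕ.^ n)))

-- The number of vertices is an index of `Digraph`, so the graph itself is transported along the
-- equation for v.
IsDSRG-≡ : ∀ {v v′} → v ≡ v′ → ∀ {k k′ l l′ μ μ′ t t′ : ℤ} → k ≡ k′ → l ≡ l′ → μ ≡ μ′ → t ≡ t′ →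
           (Σ[ G ∈ Digraph v ] IsDSRG G k l μ t) → Σ[ G ∈ Digraph v′ ] IsDSRG G k′ l′ μ′ t′
IsDSRG-≡ refl refl refl refl refl G = G

theorem3p1 : (p s d w z₁ : ℕ) (z₂ : ℤ) →
    Prime p →
    1 ℕ.≤ s →
    1 ℕ.≤ d →
    1 ℕ.≤ w →
    w ℕ.≤ p ℕ.^ d →
    1 ℕ.≤ z₁ →
    + z₁ ≤ (+ p) ^ d - (+ w) + (+ 1) →
    (w ≡ 1 → z₂ ≡ + 1) →
    (2 ℕ.≤ w → w ℕ.≤ p ℕ.^ d → (z₂ ≡ (+ w) - (+ 1)) ⊎ (z₂ ≡ + w)) →
    let q = (+ p) ^ (s ℕ.* d)
        W = + w
        Z = + z₁
    in
    Σ[ G ∈ Digraph ((z₁ ℕ.+ 1) ℕ.* p ℕ.^ (2 ℕ.* s ℕ.* d)) ]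
      IsDSRG G
        ((q - (+ 1)) * W + Z * z₂ * q)
        (q + W ^ 2 - (+ 3) * W + Z * z₂ ^ 2)
        (W ^ 2 - W + Z * z₂ ^ 2)
        (q * W - W + Z * z₂ ^ 2)
-- Matching w as `suc k` exposes k = w - 1, the number of classes common to all blocks.
theorem3p1 p s d (suc k) z₁ z₂ pr 1≤s 1≤d 1≤w w≤p^d 1≤z₁ z₁≤ w≡1⇒ 2≤w⇒ =
  IsDSRG-≡ order (degree≡ (+ k) (+ z₁)) (adjacent≡ (+ k) (+ z₁)) (nonAdjacent≡ (+ k) (+ z₁)) (reciprocal≡ (+ k) (+ z₁))
    (BlockGraph.blockGraph net 1≤z₁ z₂ z₂-root X X-zeroOne X-row X-column)
  where
  w = suc k
  m = p ℕ.^ d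
  q = m ℕ.^ s

  instance
    p≢0 : ℕ.NonZero p
    p≢0 = prime⇒nonZero pr
    m≢0 : ℕ.NonZero m
    m≢0 = ℕ.m^n≢0 p d
    q≢0 : ℕ.NonZero q
    q≢0 = ℕ.m^n≢0 m s

  -- For w = 1 only z = w occurs. In all cases z₂ is a natural number equal to w - 1 or w.
  z₂-cases : ∃ λ z → z₂ ≡ + z × (z ≡ k ⊎ z ≡ w)
  z₂-cases = go k w≡1⇒ 2≤w⇒ w≤p^d
    where
    go : ∀ k → (suc k ≡ 1 → z₂ ≡ + 1) →
         (2 ℕ.≤ suc k → suc k ℕ.≤ p ℕ.^ d → (z₂ ≡ + suc k - + 1) ⊎ (z₂ ≡ + suc k)) →
         suc k ℕ.≤ p ℕ.^ d → ∃ λ z → z₂ ≡ + z × (z ≡ k ⊎ z ≡ suc k)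
    go zero    one _ _ = 1 , one refl , inj₂ refl
    go (suc k) _ big ≤m with big (s≤s (s≤s z≤n)) ≤m
    ... | inj₁ e = suc k , e , inj₁ refl
    ... | inj₂ e = suc (suc k) , e , inj₂ refl

  z : ℕ
  z = proj₁ z₂-cases

  z₂≡z : z₂ ≡ + z
  z₂≡z = proj₁ (proj₂ z₂-cases)

  -- The chain is z ≤ w ≤ p^d ≤ q, the last inequality by s ≥ 1.
  z≤q : z ℕ.≤ q
  z≤q = ℕ.≤-trans (go (proj₂ (proj₂ z₂-cases))) (ℕ.≤-trans w≤p^d
    (ℕ.≤-trans (ℕ.≤-reflexive (sym (ℕ.*-identityʳ m))) (ℕ.^-monoʳ-≤ m 1≤s)))
    where
    go : z ≡ k ⊎ z ≡ w → z ℕ.≤ w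
    go (inj₁ e) = ℕ.≤-trans (ℕ.≤-reflexive e) (ℕ.n≤1+n k)
    go (inj₂ e) = ℕ.≤-reflexive e

  z₂-root : (z₂ - + k) * (z₂ - + k - + 1) ≡ + 0
  z₂-root = trans (cong (λ z → (z - + k) * (z - + k - + 1)) z₂≡z) (go (proj₂ (proj₂ z₂-cases)))
    where
    go : z ≡ k ⊎ z ≡ w → (+ z - + k) * (+ z - + k - + 1) ≡ + 0
    go (inj₁ e) = trans (cong (λ z → (+ z - + k) * (+ z - + k - + 1)) e) (lemma (+ k))
      where
      lemma : ∀ k → (k - k) * (k - k - + 1) ≡ + 0
      lemma = solve-∀
    go (inj₂ e) = trans (cong (λ z → (+ z - + k) * (+ z - + k - + 1)) e) (lemma (+ k))
      where
      lemma : ∀ k → (+ 1 + k - k) * (+ 1 + k - k - + 1) ≡ + 0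
      lemma = solve-∀

  -- The bound on z₁ amounts to w + z₁ ≤ p^d + 1, so the affine plane has enough parallel classes.
  classes≤ : k ℕ.+ suc z₁ ℕ.≤ suc m
  classes≤ = ℤ.drop‿+≤+ (subst₂ _≤_ (left (+ k) (+ z₁)) (right (+ k) (+ m))
    (ℤ.+-monoʳ-≤ (+ w) (subst (λ m → + z₁ ≤ m - + w + + 1) (pos-^ p d) z₁≤)))
    where
    left : ∀ k z₁ → (+ 1 + k) + z₁ ≡ k + (+ 1 + z₁)
    left = solve-∀
    right : ∀ k m → (+ 1 + k) + (m - (+ 1 + k) + + 1) ≡ + 1 + m
    right = solve-∀

  net : Net (k ℕ.+ suc z₁) q
  net = restrict classes≤ (Power.power (AffinePlane.affinePlane (finiteDomain pr 1≤d)) s)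

  open Circulant q z z≤q

  X : Fin q → Fin q → ℤ
  X = circulant

  X-zeroOne : ∀ u v → ZeroOne (X u v)
  X-zeroOne u v = zeroOne-⟦⟧ _

  X-row : ∀ u → _ ≡ z₂
  X-row u = trans (circulant-row u) (sym z₂≡z)

  X-column : ∀ v → _ ≡ z₂
  X-column v = trans (circulant-column v) (sym z₂≡z)

  q≡ : + q ≡ (+ p) ^ (s ℕ.* d)
  q≡ = sym (trans (pos-^ p (s ℕ.* d)) (cong +_ (trans (cong (p ℕ.^_) (ℕ.*-comm s d)) (sym (ℕ.^-*-assoc p d s)))))

  order : suc z₁ ℕ.* (q ℕ.* q) ≡ (z₁ ℕ.+ 1) ℕ.* p ℕ.^ (2 ℕ.* s ℕ.* d)
  order = cong₂ ℕ._*_ (ℕ.+-comm 1 z₁) (begin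
    q ℕ.* q                            ≡⟨ ℕ.^-distribˡ-+-* m s s ⟨
    m ℕ.^ (s ℕ.+ s)                    ≡⟨ ℕ.^-*-assoc p d (s ℕ.+ s) ⟩
    p ℕ.^ (d ℕ.* (s ℕ.+ s))            ≡⟨ cong (p ℕ.^_) (ℕ.*-comm d (s ℕ.+ s)) ⟩
    p ℕ.^ ((s ℕ.+ s) ℕ.* d)            ≡⟨ cong (λ e → p ℕ.^ ((s ℕ.+ e) ℕ.* d)) (ℕ.+-identityʳ s) ⟨
    p ℕ.^ (2 ℕ.* s ℕ.* d)              ∎)
    where open ≡-Reasoning

  -- The four parameter equations are stated for integers k and z₁; as `+ suc k` is `+ 1 + + k` by
  -- computation, they apply to w directly.
  degree≡ : ∀ k z₁ → (k + + 1) * + q + z₁ * z₂ * + q - (k + + 1) ≡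
    ((+ p) ^ (s ℕ.* d) - + 1) * (+ 1 + k) + z₁ * z₂ * (+ p) ^ (s ℕ.* d)
  degree≡ k z₁ = trans (lemma k z₁ z₂ (+ q)) (cong (λ q → (q - + 1) * (+ 1 + k) + z₁ * z₂ * q) q≡)
    where
    lemma : ∀ k z₁ z q → (k + + 1) * q + z₁ * z * q - (k + + 1) ≡ (q - + 1) * (+ 1 + k) + z₁ * z * q
    lemma = solve-∀

  nonAdjacent≡ : ∀ k z₁ → (k + + 1) * (k + + 1) - (k + + 1) + z₁ * (z₂ * z₂) ≡ (+ 1 + k) ^ 2 - (+ 1 + k) + z₁ * z₂ ^ 2
  nonAdjacent≡ k z₁ = lemma k z₁ z₂
    where
    -- Squares are written as the products to which `^ 2` reduces.
    lemma : ∀ k z₁ z → (k + + 1) * (k + + 1) - (k + + 1) + z₁ * (z * z) ≡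
      (+ 1 + k) * ((+ 1 + k) * + 1) - (+ 1 + k) + z₁ * (z * (z * + 1))
    lemma = solve-∀

  adjacent≡ : ∀ k z₁ → + q + ((k + + 1) * (k + + 1) - (k + + 1) + z₁ * (z₂ * z₂)) - (k + + 1) - (k + + 1) ≡
    (+ p) ^ (s ℕ.* d) + (+ 1 + k) ^ 2 - + 3 * (+ 1 + k) + z₁ * z₂ ^ 2
  adjacent≡ k z₁ = trans (lemma k z₁ z₂ (+ q)) (cong (λ q → q + (+ 1 + k) ^ 2 - + 3 * (+ 1 + k) + z₁ * z₂ ^ 2) q≡)
    where
    lemma : ∀ k z₁ z q → q + ((k + + 1) * (k + + 1) - (k + + 1) + z₁ * (z * z)) - (k + + 1) - (k + + 1) ≡
      q + (+ 1 + k) * ((+ 1 + k) * + 1) - + 3 * (+ 1 + k) + z₁ * (z * (z * + 1))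
    lemma = solve-∀

  reciprocal≡ : ∀ k z₁ → + q * (k + + 1) + ((k + + 1) * (k + + 1) - (k + + 1) + z₁ * (z₂ * z₂)) - (k + + 1) * (k + + 1) ≡
    (+ p) ^ (s ℕ.* d) * (+ 1 + k) - (+ 1 + k) + z₁ * z₂ ^ 2
  reciprocal≡ k z₁ = trans (lemma k z₁ z₂ (+ q)) (cong (λ q → q * (+ 1 + k) - (+ 1 + k) + z₁ * z₂ ^ 2) q≡)
    where
    lemma : ∀ k z₁ z q → q * (k + + 1) + ((k + + 1) * (k + + 1) - (k + + 1) + z₁ * (z * z)) - (k + + 1) * (k + + 1) ≡
      q * (+ 1 + k) - (+ 1 + k) + z₁ * (z * (z * + 1))
    lemma = solve-∀
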